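{- Fix $d\ge2$. The number of combinatorially distinct simplicial LC (locally constructible) $d$-spheres with $N$ facets grows not faster than $2^{d^2\cdot N}$; that is, for all sufficiently large $N$ there are at most $2^{d^2 N}$ combinatorial types of simplicial LC $d$-spheres with $N$ facets.
   Context: All complexes are finite. A simplicial $d$-sphere is a simplicial complex whose underlying space is homeomorphic to the $d$-sphere; facets are its $d$-dimensional faces. Combinatorially distinct means non-isomorphic as simplicial complexes. LC: A regular CW complex is simplicial if every lower interval $[0,F]$ in its face poset is boolean. A $d$-pseudomanifold is a finite, pure $d$-dimensional, simplicial regular CW complex in which each $(d-1)$-cell belongs to at most two $d$-cells; its boundary is the smallest subcomplex containing all $(d-1)$-cells that lie in exactly one $d$-cell. For $d\ge2$, a local construction for a pure $d$-dimensional simplicial complex $C$ with $N$ facets is a sequence $T_1,\dots,T_N,\dots,T_k$ ($k\ge N$) of $d$-pseudomanifolds such that: (1) $T_1$ is a $d$-simplex; (2) for $i\le N-1$, $T_{i+1}$ is obtained from $T_i$ by gluing a new $d$-simplex to $T_i$ along one of the $(d-1)$-cells of $\partial T_i$; (3) for $i\ge N$, $T_{i+1}$ is obtained from $T_i$ by identifying a pair of $(d-1)$-cells $\sigma,\tau$ in $\partial T_i$ whose intersection contains a $(d-2)$-cell $F$ (the identification being the simplicial one that fixes $F$ pointwise); (4) $T_k=C$. $C$ is LC if a local construction for $C$ exists. -}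

module Defs where

open import Data.Bool.Base using (true; false)
open import Data.Fin.Base using (Fin)
open import Data.Fin.Permutation using (Permutation; _⟨$⟩ʳ_)
open import Data.Fin.Subset using (Subset; _∉_; _⊆_; ∣_∣; ⊥; ⁅_⁆)
open import Data.Fin.Subset.Properties using (⊆-poset)
open import Data.List.Base as List using (List; []; _∷_; _++_; filter; length)
open import Data.Nat.Base as ℕ using (ℕ; zero; suc)
import Data.Nat.Properties as ℕ
open import Data.Product.Base using (Σ-syntax; ∃; ∃-syntax; _×_; _,_; proj₁; proj₂)
open import Data.Product using (∃!)
open import Data.Rational.Base as ℚ using (ℚ; 0ℚ; 1ℚ; ½)
import Data.Rational.Properties as ℚ
open import Data.Sum.Base using (_⊎_; inj₁; inj₂)
open import Data.Sum.Relation.Binary.Pointwise using (⊎-poset)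
open import Data.Vec.Base as Vec using (lookup; tabulate)
import Data.Vec.Functional as Vector
open import Function.Base using (_∘_)
open import Function.Bundles using (_⇔_)
open import Level using (0ℓ)
open import Relation.Binary.Bundles using (Poset)
open import Relation.Binary.Construct.Closure.Equivalence using (EqClosure)
import Relation.Binary.Construct.On as On
open import Relation.Binary.Core using (Rel)
open import Relation.Binary.Definitions using (Minimum)
open import Relation.Binary.Morphism.Structures using (IsOrderIsomorphism)
open import Relation.Binary.PropositionalEquality using (_≡_; _≢_; refl; sym; trans; cong; cong₂; subst)
open import Relation.Binary.Structures using (IsPartialOrder)
open import Relation.Nullary.Decidable.Core using (_×-dec_; dec⇒maybe)
open import Relation.Nullary.Negation.Core using (¬_)
open import Relation.Unary using (Pred; Decidable)
open import Tactic.RingSolver using (solve-∀)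
open import Tactic.RingSolver.Core.AlmostCommutativeRing
  using (AlmostCommutativeRing; fromCommutativeRing)

module Real where

  Cauchy : (ℕ → ℚ) → Set
  Cauchy s = ∀ ε → 0ℚ ℚ.< ε →
    ∃[ K ] ∀ m n → K ℕ.≤ m → K ℕ.≤ n → ℚ.∣ s m ℚ.- s n ∣ ℚ.< ε

  record ℝ : Set where
    constructor mkℝ
    field
      approx : ℕ → ℚ
      cauchy : Cauchy approx

  open ℝ public

  infix 4 _≃_ _<_ _≤_

  _≃_ : Rel ℝ 0ℓ
  x ≃ y = ∀ ε → 0ℚ ℚ.< ε →
    ∃[ K ] ∀ n → K ℕ.≤ n → ℚ.∣ approx x n ℚ.- approx y n ∣ ℚ.< ε

  _<_ : Rel ℝ 0ℓ
  x < y = ∃[ ε ] 0ℚ ℚ.< ε ×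
    ∃[ K ] ∀ n → K ℕ.≤ n → approx x n ℚ.+ ε ℚ.< approx y n

  _≤_ : Rel ℝ 0ℓ
  x ≤ y = ¬ (y < x)

  private
    ℚ-ring : AlmostCommutativeRing 0ℓ 0ℓ
    ℚ-ring = fromCommutativeRing ℚ.+-*-commutativeRing (λ q → dec⇒maybe (0ℚ ℚ.≟ q))

    abstract
      neg-sub : ∀ a b → ℚ.- (a ℚ.- b) ≡ (ℚ.- a) ℚ.- (ℚ.- b)
      neg-sub = solve-∀ ℚ-ring

      sub-add : ∀ a b → a ≡ (a ℚ.- b) ℚ.+ b
      sub-add = solve-∀ ℚ-ring

      add-sub-add : ∀ a b c d → (a ℚ.+ b) ℚ.- (c ℚ.+ d) ≡ (a ℚ.- c) ℚ.+ (b ℚ.- d)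
      add-sub-add = solve-∀ ℚ-ring

      mul-sub-mul : ∀ a b c d → a ℚ.* b ℚ.- c ℚ.* d ≡ a ℚ.* (b ℚ.- d) ℚ.+ d ℚ.* (a ℚ.- c)
      mul-sub-mul = solve-∀ ℚ-ring

      0<½*_ : ∀ {ε} → 0ℚ ℚ.< ε → 0ℚ ℚ.< ½ ℚ.* ε
      0<½*_ {ε} 0<ε = ℚ.positive⁻¹ (½ ℚ.* ε) {{ℚ.pos*pos⇒pos ½ ε {{ℚ.positive 0<ε}}}}

      halves : ∀ ε → ½ ℚ.* ε ℚ.+ ½ ℚ.* ε ≡ ε
      halves ε = trans (sym (ℚ.*-distribʳ-+ ε ½ ½)) (ℚ.*-identityˡ ε)

      const-cauchy : ∀ q → Cauchy (λ _ → q)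
      const-cauchy q ε 0<ε =
        0 , λ _ _ _ _ → subst (ℚ._< ε) (sym (cong ℚ.∣_∣ (ℚ.+-inverseʳ q))) 0<ε

      +-cauchy : ∀ s t → Cauchy s → Cauchy t → Cauchy (λ n → s n ℚ.+ t n)
      +-cauchy s t cs ct ε 0<ε with cs _ (0<½* 0<ε) | ct _ (0<½* 0<ε)
      ... | K , hs | L , ht = K ℕ.⊔ L , λ m n p q → begin-strict
        ℚ.∣ (s m ℚ.+ t m) ℚ.- (s n ℚ.+ t n) ∣
          ≡⟨ cong ℚ.∣_∣ (add-sub-add (s m) (t m) (s n) (t n)) ⟩
        ℚ.∣ (s m ℚ.- s n) ℚ.+ (t m ℚ.- t n) ∣
          ≤⟨ ℚ.∣p+q∣≤∣p∣+∣q∣ (s m ℚ.- s n) (t m ℚ.- t n) ⟩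
        ℚ.∣ s m ℚ.- s n ∣ ℚ.+ ℚ.∣ t m ℚ.- t n ∣
          <⟨ ℚ.+-mono-< (hs m n (ℕ.m⊔n≤o⇒m≤o K L p) (ℕ.m⊔n≤o⇒m≤o K L q))
                        (ht m n (ℕ.m⊔n≤o⇒n≤o K L p) (ℕ.m⊔n≤o⇒n≤o K L q)) ⟩
        ½ ℚ.* ε ℚ.+ ½ ℚ.* ε ≡⟨ halves ε ⟩
        ε ∎
        where open ℚ.≤-Reasoning

      neg-cauchy : ∀ s → Cauchy s → Cauchy (λ n → ℚ.- s n)
      neg-cauchy s cs ε 0<ε with cs ε 0<ε
      ... | K , hs = K , λ m n p q →
        subst (ℚ._< ε)
          (trans (sym (ℚ.∣-p∣≡∣p∣ (s m ℚ.- s n)))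
                 (cong ℚ.∣_∣ (neg-sub (s m) (s n))))
          (hs m n p q)

      bounded : ∀ s → Cauchy s →
        ∃[ B ] ℚ.Positive B × ∃[ K ] ∀ n → K ℕ.≤ n → ℚ.∣ s n ∣ ℚ.≤ B
      bounded s cs with cs 1ℚ (ℚ.positive⁻¹ 1ℚ)
      ... | K , hs = 1ℚ ℚ.+ ℚ.∣ s K ∣
                   , ℚ.pos+nonNeg⇒pos 1ℚ ℚ.∣ s K ∣ {{ℚ.∣-∣-nonNeg (s K)}}
                   , K , λ n p → begin
        ℚ.∣ s n ∣
          ≡⟨ cong ℚ.∣_∣ (sub-add (s n) (s K)) ⟩
        ℚ.∣ (s n ℚ.- s K) ℚ.+ s K ∣       ≤⟨ ℚ.∣p+q∣≤∣p∣+∣q∣ (s n ℚ.- s K) (s K) ⟩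
        ℚ.∣ s n ℚ.- s K ∣ ℚ.+ ℚ.∣ s K ∣
          ≤⟨ ℚ.+-monoˡ-≤ ℚ.∣ s K ∣ (ℚ.<⇒≤ (hs n K p ℕ.≤-refl)) ⟩
        1ℚ ℚ.+ ℚ.∣ s K ∣ ∎
        where open ℚ.≤-Reasoning

      product-bound : ∀ {A B δ} a b c d → ℚ.Positive A → ℚ.Positive B →
        ℚ.∣ a ∣ ℚ.≤ A → ℚ.∣ d ∣ ℚ.≤ B → ℚ.∣ a ℚ.- c ∣ ℚ.< δ → ℚ.∣ b ℚ.- d ∣ ℚ.< δ →
        ℚ.∣ a ℚ.* b ℚ.- c ℚ.* d ∣ ℚ.< A ℚ.* δ ℚ.+ B ℚ.* δ
      product-bound {A} {B} {δ} a b c d A>0 B>0 a≤A d≤B ac<δ bd<δ = begin-strict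
        ℚ.∣ a ℚ.* b ℚ.- c ℚ.* d ∣
          ≡⟨ cong ℚ.∣_∣ (mul-sub-mul a b c d) ⟩
        ℚ.∣ a ℚ.* (b ℚ.- d) ℚ.+ d ℚ.* (a ℚ.- c) ∣
          ≤⟨ ℚ.∣p+q∣≤∣p∣+∣q∣ (a ℚ.* (b ℚ.- d)) (d ℚ.* (a ℚ.- c)) ⟩
        ℚ.∣ a ℚ.* (b ℚ.- d) ∣ ℚ.+ ℚ.∣ d ℚ.* (a ℚ.- c) ∣
          ≡⟨ cong₂ ℚ._+_ (ℚ.∣p*q∣≡∣p∣*∣q∣ a (b ℚ.- d)) (ℚ.∣p*q∣≡∣p∣*∣q∣ d (a ℚ.- c)) ⟩
        ℚ.∣ a ∣ ℚ.* ℚ.∣ b ℚ.- d ∣ ℚ.+ ℚ.∣ d ∣ ℚ.* ℚ.∣ a ℚ.- c ∣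
          ≤⟨ ℚ.+-mono-≤
               (ℚ.*-monoʳ-≤-nonNeg ℚ.∣ b ℚ.- d ∣ {{ℚ.∣-∣-nonNeg (b ℚ.- d)}} a≤A)
               (ℚ.*-monoʳ-≤-nonNeg ℚ.∣ a ℚ.- c ∣ {{ℚ.∣-∣-nonNeg (a ℚ.- c)}} d≤B) ⟩
        A ℚ.* ℚ.∣ b ℚ.- d ∣ ℚ.+ B ℚ.* ℚ.∣ a ℚ.- c ∣
          <⟨ ℚ.+-mono-< (ℚ.*-monoʳ-<-pos A {{A>0}} bd<δ) (ℚ.*-monoʳ-<-pos B {{B>0}} ac<δ) ⟩
        A ℚ.* δ ℚ.+ B ℚ.* δ ∎
        where open ℚ.≤-Reasoning

      divide : ∀ A ε → ℚ.Positive A → 0ℚ ℚ.< ε → ∃[ δ ] 0ℚ ℚ.< δ × A ℚ.* δ ≡ ε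
      divide A ε A>0 0<ε =
          A⁻¹ ℚ.* ε
        , ℚ.positive⁻¹ (A⁻¹ ℚ.* ε)
            {{ℚ.pos*pos⇒pos A⁻¹ {{ℚ.1/pos⇒pos A {{A>0}}}} ε {{ℚ.positive 0<ε}}}}
        , trans (sym (ℚ.*-assoc A A⁻¹ ε))
            (trans (cong (ℚ._* ε) (ℚ.*-inverseʳ A {{A≢0}})) (ℚ.*-identityˡ ε))
        where
        A≢0 : ℚ.NonZero A
        A≢0 = ℚ.pos⇒nonZero A {{A>0}}
        A⁻¹ : ℚ
        A⁻¹ = ℚ.1/_ A {{A≢0}}

      *-cauchy : ∀ s t → Cauchy s → Cauchy t → Cauchy (λ n → s n ℚ.* t n)
      *-cauchy s t cs ct ε 0<ε =
        let A , A>0 , I , hA  = bounded s cs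
            B , B>0 , J , hB  = bounded t ct
            δ , 0<δ , A+B*δ≡ε = divide (A ℚ.+ B) ε (ℚ.pos+pos⇒pos A {{A>0}} B {{B>0}}) 0<ε
            K , hs            = cs δ 0<δ
            L , ht            = ct δ 0<δ
        in (I ℕ.⊔ J) ℕ.⊔ (K ℕ.⊔ L) , λ m n p q →
          let p₁ = ℕ.m⊔n≤o⇒m≤o (I ℕ.⊔ J) (K ℕ.⊔ L) p
              p₂ = ℕ.m⊔n≤o⇒n≤o (I ℕ.⊔ J) (K ℕ.⊔ L) p
              q₁ = ℕ.m⊔n≤o⇒m≤o (I ℕ.⊔ J) (K ℕ.⊔ L) q
              q₂ = ℕ.m⊔n≤o⇒n≤o (I ℕ.⊔ J) (K ℕ.⊔ L) q
          in subst (ℚ.∣ s m ℚ.* t m ℚ.- s n ℚ.* t n ∣ ℚ.<_)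
               (trans (sym (ℚ.*-distribʳ-+ δ A B)) A+B*δ≡ε)
               (product-bound (s m) (t m) (s n) (t n) A>0 B>0
                 (hA m (ℕ.m⊔n≤o⇒m≤o I J p₁)) (hB n (ℕ.m⊔n≤o⇒n≤o I J q₁))
                 (hs m n (ℕ.m⊔n≤o⇒m≤o K L p₂) (ℕ.m⊔n≤o⇒m≤o K L q₂))
                 (ht m n (ℕ.m⊔n≤o⇒n≤o K L p₂) (ℕ.m⊔n≤o⇒n≤o K L q₂)))

  infixl 6 _+_ _-_
  infixl 7 _*_
  infix  8 -_

  fromℚ : ℚ → ℝ
  fromℚ q = mkℝ (λ _ → q) (const-cauchy q)

  0ℝ 1ℝ : ℝ
  0ℝ = fromℚ 0ℚ
  1ℝ = fromℚ 1ℚ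

  _+_ _*_ : ℝ → ℝ → ℝ
  mkℝ s cs + mkℝ t ct = mkℝ (λ n → s n ℚ.+ t n) (+-cauchy s t cs ct)
  mkℝ s cs * mkℝ t ct = mkℝ (λ n → s n ℚ.* t n) (*-cauchy s t cs ct)

  -_ : ℝ → ℝ
  - mkℝ s cs = mkℝ (λ n → ℚ.- s n) (neg-cauchy s cs)

  _-_ : ℝ → ℝ → ℝ
  x - y = x + (- y)

  sum : ∀ {n} → (Fin n → ℝ) → ℝ
  sum = Vector.foldr _+_ 0ℝ

open Real using (ℝ; 0ℝ; 1ℝ)

Space : ℕ → Set₁
Space n = Pred (Fin n → ℝ) 0ℓ

Point : ∀ {n} → Space n → Set
Point = ∃

_≈ₚ_ : ∀ {n} → Rel (Fin n → ℝ) 0ℓ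
x ≈ₚ y = ∀ i → x i Real.≃ y i

-- The square of the Euclidean distance; it induces the same topology.
dist² : ∀ {n} → (Fin n → ℝ) → (Fin n → ℝ) → ℝ
dist² x y = Real.sum λ i → (x i Real.- y i) Real.* (x i Real.- y i)

Continuous : ∀ {m n} (X : Space m) (Y : Space n) → (Point X → Point Y) → Set
Continuous X Y f = ∀ (p : Point X) ε → 0ℝ Real.< ε →
  ∃[ δ ] 0ℝ Real.< δ ×
    (∀ (q : Point X) → dist² (proj₁ p) (proj₁ q) Real.< δ →
      dist² (proj₁ (f p)) (proj₁ (f q)) Real.< ε)

-- Continuity forces both maps to respect ≈ₚ.
record Homeomorphic {m n} (X : Space m) (Y : Space n) : Set where
  field
    to        : Point X → Point Y
    from      : Point Y → Point X
    to-cont   : Continuous X Y to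
    from-cont : Continuous Y X from
    to∘from   : ∀ q → proj₁ (to (from q)) ≈ₚ proj₁ q
    from∘to   : ∀ p → proj₁ (from (to p)) ≈ₚ proj₁ p

Sphere : ∀ d → Space (suc d)
Sphere d x = Real.sum (λ i → x i Real.* x i) Real.≃ 1ℝ

record SimplicialComplex : Set₁ where
  field
    #vertices  : ℕ
    Face       : Pred (Subset #vertices) 0ℓ
    Face?      : Decidable Face
    ∅-face     : Face ⊥
    vertex     : ∀ v → Face ⁅ v ⁆
    downClosed : ∀ {s t} → s ⊆ t → Face t → Face s

  facePoset : Poset 0ℓ 0ℓ 0ℓ
  facePoset = On.poset (⊆-poset #vertices) (proj₁ {B = Face})

  -- Points are given by their barycentric coordinates.
  realization : Space #vertices
  realization x = (∀ v → 0ℝ Real.≤ x v)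
                × Real.sum x Real.≃ 1ℝ
                × ∃[ s ] Face s × (∀ v → v ∉ s → x v Real.≃ 0ℝ)

preimage : ∀ {m n} → (Fin m → Fin n) → Subset n → Subset m
preimage f s = tabulate (lookup s ∘ f)

Isomorphic : SimplicialComplex → SimplicialComplex → Set
Isomorphic C D =
  Σ[ π ∈ Permutation C.#vertices D.#vertices ]
    ∀ s → C.Face (preimage (π ⟨$⟩ʳ_) s) ⇔ D.Face s
  where
  module C = SimplicialComplex C
  module D = SimplicialComplex D

allSubsets : ∀ n → List (Subset n)
allSubsets zero    = Vec.[] ∷ []
allSubsets (suc n) = List.map (true Vec.∷_) (allSubsets n) ++ List.map (false Vec.∷_) (allSubsets n)

#facets : ℕ → SimplicialComplex → ℕ
#facets d C = length (filter (λ s → Face? s ×-dec (∣ s ∣ ℕ.≟ suc d)) (allSubsets #vertices))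
  where open SimplicialComplex C

Pure : ℕ → SimplicialComplex → Set
Pure d C = ∀ s → Face s → ∃[ t ] Face t × ∣ t ∣ ≡ suc d × s ⊆ t
  where open SimplicialComplex C

IsSphere : ℕ → SimplicialComplex → Set
IsSphere d C = Homeomorphic (SimplicialComplex.realization C) (Sphere d)

infix 4 _≅_

record _≅_ (P Q : Poset 0ℓ 0ℓ 0ℓ) : Set where
  private
    module P = Poset P
    module Q = Poset Q
  field
    to                 : P.Carrier → Q.Carrier
    isOrderIsomorphism : IsOrderIsomorphism P._≈_ Q._≈_ P._≤_ Q._≤_ to

↓ : (P : Poset 0ℓ 0ℓ 0ℓ) → Poset.Carrier P → Poset 0ℓ 0ℓ 0ℓ
↓ P x = On.poset P (proj₁ {B = λ y → Poset._≤_ P y x})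

-- A regular CW complex is determined up to cellular homeomorphism by its
-- face poset, and every poset as below is the face poset of one.  The
-- least element is the empty cell; a cell of dimension k has rank k + 1.
record SimplicialCWComplex : Set₁ where
  infix 4 _⊑_
  field
    #cells         : ℕ

  Cell : Set
  Cell = Fin #cells

  field
    _⊑_            : Rel Cell 0ℓ
    isPartialOrder : IsPartialOrder _≡_ _⊑_
    ∅              : Cell
    minimum        : Minimum _⊑_ ∅

  facePoset : Poset 0ℓ 0ℓ 0ℓ
  facePoset = record { isPartialOrder = isPartialOrder }

  field
    rank           : Cell → ℕ
    boolean        : ∀ F → ↓ facePoset F ≅ ⊆-poset (rank F)

record Pseudomanifold (d : ℕ) : Set₁ where
  field
    complex : SimplicialCWComplex

  open SimplicialCWComplex complex public

  IsFacetOver : Cell → Cell → Set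
  IsFacetOver F x = rank x ≡ suc d × F ⊑ x

  field
    pure       : ∀ F → ∃ (IsFacetOver F)
    atMostTwo  : ∀ σ → rank σ ≡ d → ∀ {x y z} →
                 IsFacetOver σ x → IsFacetOver σ y → IsFacetOver σ z →
                 x ≡ y ⊎ y ≡ z ⊎ x ≡ z

  ∂ : Pred Cell 0ℓ
  ∂ F = ∃[ σ ] rank σ ≡ d × ∃! _≡_ (IsFacetOver σ) × F ⊑ σ

-- Q is the face poset of the complex obtained from the one with face poset
-- P by identifying the closed cells σ and τ along φ.
record Identification
  (P : Poset 0ℓ 0ℓ 0ℓ) {σ τ : Poset.Carrier P} (φ : ↓ P σ ≅ ↓ P τ)
  (Q : Poset 0ℓ 0ℓ 0ℓ) : Set where
  private
    module P = Poset P
    module Q = Poset Q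

  Matched : Rel P.Carrier 0ℓ
  Matched x y = x P.≈ y ⊎ (Σ[ x≤σ ∈ x P.≤ σ ] proj₁ (_≅_.to φ (x , x≤σ)) P.≈ y)

  field
    quot       : P.Carrier → Q.Carrier
    surjective : ∀ b → ∃[ x ] quot x Q.≈ b
    kernel     : ∀ x y → quot x Q.≈ quot y ⇔ EqClosure Matched x y
    order      : ∀ b c → b Q.≤ c ⇔ (∃[ x ] ∃[ y ] quot x Q.≈ b × quot y Q.≈ c × x P.≤ y)
    -- No closed cell is glued to itself.  If Q is again the face poset of a
    -- simplicial regular CW complex this is automatic: otherwise some edge
    -- would become a loop.
    regular    : ∀ {x y z} → x P.≤ z → y P.≤ z → quot x Q.≈ quot y → x P.≈ y

module _ {d : ℕ} (T T′ : Pseudomanifold d) where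
  private
    module T  = Pseudomanifold T
    module T′ = Pseudomanifold T′

  -- The disjoint union has two empty cells, but they are identified by φ.
  record AttachSimplex : Set where
    private
      T⊎Δ : Poset 0ℓ 0ℓ 0ℓ
      T⊎Δ = ⊎-poset T.facePoset (⊆-poset (suc d))
    field
      σ        : T.Cell
      σ-dim    : T.rank σ ≡ d
      σ∈∂      : T.∂ σ
      τ        : Subset (suc d)
      τ-dim    : ∣ τ ∣ ≡ d
      φ        : ↓ T⊎Δ (inj₁ σ) ≅ ↓ T⊎Δ (inj₂ τ)
      identify : Identification T⊎Δ φ T′.facePoset

  record FoldPair : Set where
    field
      σ τ      : T.Cell
      σ≢τ      : σ ≢ τ
      σ-dim    : T.rank σ ≡ d
      τ-dim    : T.rank τ ≡ d
      σ∈∂      : T.∂ σ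
      τ∈∂      : T.∂ τ
      F        : T.Cell
      F-dim    : suc (T.rank F) ≡ d
      F⊑σ      : F T.⊑ σ
      F⊑τ      : F T.⊑ τ
      φ        : ↓ T.facePoset σ ≅ ↓ T.facePoset τ
      φ-fixes  : ∀ x (x⊑σ : x T.⊑ σ) → x T.⊑ F → proj₁ (_≅_.to φ (x , x⊑σ)) ≡ x
      identify : Identification T.facePoset φ T′.facePoset

-- Only the terms T 1, …, T k of the sequence matter.
record LocalConstruction (d : ℕ) (C : SimplicialComplex) : Set₁ where
  private
    N = #facets d C
  field
    k      : ℕ
    N≤k    : N ℕ.≤ k
    T      : ℕ → Pseudomanifold d
    start  : Pseudomanifold.facePoset (T 1) ≅ ⊆-poset (suc d)
    attach : ∀ i → 1 ℕ.≤ i → i ℕ.< N → AttachSimplex (T i) (T (suc i))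
    fold   : ∀ i → N ℕ.≤ i → i ℕ.< k → FoldPair (T i) (T (suc i))
    end    : Pseudomanifold.facePoset (T k) ≅ SimplicialComplex.facePoset C

IsLC : ℕ → SimplicialComplex → Set₁
IsLC d C = Pure d C × LocalConstruction d C

-- A locally constructible complex arises from a tree of N d-simplices by folding pairs
-- of boundary facets along common ridges.  Cut at a facet of the first simplex, the tree
-- consists of two d-ary trees with N nodes and (d − 1)N + 2 leaves altogether, so dN + 2
-- bits determine it; the leaves are the boundary facets.  Label a leaf by the ridge along
-- which the facet is folded, if it is folded at all: d + 1 possibilities.
--
-- The order of the folds need not be recorded.  At any time a ridge lies in at most two
-- facets of the boundary, so after a fold along a ridge no boundary facet contains that
-- ridge, and its class is never enlarged again.  Hence two labelled facets whose labels
-- name the same ridge of the final complex are folded onto each other.  By induction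
-- along the folds of one complex, all its identifications therefore hold in every other
-- complex with the same labelled tree, and the two complexes are isomorphic.
--
-- Finally 2 ^ (dN + 2) · (d + 1) ^ ((d − 1)N + 2) ≤ 2 ^ (d²N) for large N, because
-- d + 1 ≤ ¾ · 2 ^ d.

module Submission where

open import Data.Bool.Base using (Bool; true; false)
import Data.Bool.Properties as Bool
open import Data.Fin.Base as Fin using (Fin; zero; suc; punchIn; combine; funToFin; finToFun)
open import Data.Fin.Permutation using (Permutation; permutation)
import Data.Fin.Properties as Fin
open import Data.Fin.Subset using (Subset; inside; outside; _∈_; _⊆_; ∣_∣; ⊤; ⊥; ⁅_⁆)
open import Data.Fin.Subset.Properties
  using ( ⊆-poset; ⊆-refl; ⊆-reflexive; ⊆-antisym; ⊆-max; ⊆-min; ∈⊤; ∉⊥; drop-∷-⊆; drop-there; s⊆s; out⊆; in⊆in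
        ; ∣p∣≡n⇒p≡⊤; ∣p∣≤n; ∣⊤∣≡n; p⊆q⇒∣p∣≤∣q∣; nonempty?; x∈⁅x⁆; x∈⁅y⁆⇒x≡y)
open import Data.List.Base using (List; []; _∷_; _++_; _∷ʳ_; length)
import Data.List.Properties as List
open import Data.List.Relation.Unary.All using (All; []; _∷_)
open import Data.List.Relation.Unary.AllPairs using (AllPairs; []; _∷_)
open import Data.Maybe.Base using (Maybe; just; nothing)
open import Data.Nat.Base as ℕ using (ℕ; zero; suc; _≤_; _≤′_; ≤′-refl; ≤′-step; _+_; _*_; _^_; s≤s; z≤n)
import Data.Nat.Properties as ℕ
open import Data.Nat.Tactic.RingSolver using (solve-∀)
open import Data.Product using (∃!)
open import Data.Product.Base using (Σ-syntax; ∃; ∃-syntax; ∃₂; _×_; _,_; proj₁; proj₂; map₁)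
open import Data.Sum.Base as Sum using (_⊎_; inj₁; inj₂; [_,_])
import Data.Sum.Properties as Sum
open import Data.Sum.Relation.Binary.Pointwise using (⊎-poset; inj₁; inj₂; drop-inj₁; drop-inj₂)
open import Data.Unit.Base using (tt) renaming (⊤ to Unit)
open import Data.Vec.Base as Vec using (Vec; []; _∷_; here; there; lookup; insertAt; removeAt; replicate; _[_]≔_)
import Data.Vec.Properties as Vec
open import Function.Base using (_∘_; id; const; flip; case_of_)
open import Function.Bundles using (Equivalence; mk⇔)
open import Level using (0ℓ)
open import Relation.Binary.Bundles using (Poset)
open import Relation.Binary.Construct.Closure.Equivalence as EqC using (EqClosure)
open import Relation.Binary.Construct.Closure.ReflexiveTransitive using (ε; _◅_)
open import Relation.Binary.Construct.Closure.Symmetric using (fwd; bwd)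
open import Relation.Binary.Core using (Rel)
open import Relation.Binary.Definitions using (DecidableEquality)
open import Relation.Binary.Morphism.Structures using (IsOrderIsomorphism)
open import Relation.Binary.PropositionalEquality
  using (_≡_; _≢_; refl; sym; trans; cong; cong₂; subst; subst₂; module ≡-Reasoning)
open import Relation.Nullary using (¬_; yes; no; contradiction)
open import Relation.Nullary.Decidable using (map′; _×-dec_)
open import Relation.Unary using (Pred)
open import Defs

-- The two complexes are never compared stage by stage: the induction runs along the construction of
-- one, and of the other only the final state is seen, through `Folded`. This is why the rule for
-- folds appears there without any order, as `matched`, and why keeping it as an invariant takes the
-- further fields of `System`. The bijections along which facets are glued do not occur in the code.
-- In an attachment, the vertices of the new simplex can be renamed to match its neighbour; the
-- colours in an address do this once and for all. In a fold, the bijection is the identity on the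
-- ridge and each facet has just one further vertex, so it is forced. Intermediate stages are only
-- regular CW complexes, where vertices need not determine a cell. So cells are handled through
-- charts `c u` on the face lattice of each address simplex, and a map between complexes is replaced
-- by `Respects`: coincidences of charted faces carry over. Having this in both directions gives the
-- isomorphism.

private variable
  n m : ℕ

-- Faces of a simplex

insertAt-⊆ : ∀ f {s t : Subset n} {b b′} → s ⊆ t → (b ≡ inside → b′ ≡ inside) →
             insertAt s f b ⊆ insertAt t f b′
insertAt-⊆ zero    s⊆t b≤b′ here      = subst (λ c → zero ∈ c ∷ _) (sym (b≤b′ refl)) here
insertAt-⊆ zero    s⊆t b≤b′ (there p) = there (s⊆t p)
insertAt-⊆ (suc f) {_ ∷ _} {_ ∷ _} s⊆t b≤b′ here with here ← s⊆t here = here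
insertAt-⊆ (suc f) {_ ∷ _} {_ ∷ _} s⊆t b≤b′ (there p) =
  there (insertAt-⊆ f (drop-∷-⊆ s⊆t) b≤b′ p)

insertAt-⊆⁻ : ∀ f {s t : Subset n} {b b′} → insertAt s f b ⊆ insertAt t f b′ → s ⊆ t
insertAt-⊆⁻ zero    sub p = drop-there (sub (there p))
insertAt-⊆⁻ (suc f) {_ ∷ _} {_ ∷ _} sub here with here ← sub here = here
insertAt-⊆⁻ (suc f) {_ ∷ _} {_ ∷ _} sub (there p) =
  there (insertAt-⊆⁻ f (drop-∷-⊆ sub) p)

insertAt-∈⁻ : ∀ f {s t : Subset n} {b b′} → insertAt s f b ⊆ insertAt t f b′ →
              b ≡ inside → b′ ≡ inside
insertAt-∈⁻ f {s} {t} {b} {b′} sub refl =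
  trans (sym (Vec.insertAt-lookup t f b′))
        (Vec.[]=⇒lookup (sub (Vec.lookup⇒[]= f (insertAt s f b) (Vec.insertAt-lookup s f b))))

uninsert : ∀ f (s : Subset (suc n)) → ∃₂ λ t b → s ≡ insertAt t f b
uninsert f s = removeAt s f , lookup s f , sym (Vec.insertAt-removeAt s f)

-- The faces of the simplex on Fin (suc n) that avoid the vertex f; fac f ⊤ is the
-- facet opposite to f.
fac : Fin (suc n) → Subset n → Subset (suc n)
fac f t = insertAt t f outside

fac-⊆ : ∀ f {s t : Subset n} → s ⊆ t → fac f s ⊆ fac f t
fac-⊆ f s⊆t = insertAt-⊆ f s⊆t id

fac-injective : ∀ f {s t : Subset n} → fac f s ≡ fac f t → s ≡ t
fac-injective f {s} {t} eq = trans (sym (Vec.removeAt-insertAt s f outside))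
  (trans (cong (λ u → removeAt u f) eq) (Vec.removeAt-insertAt t f outside))

⊆-fac : ∀ f {s} {t : Subset n} → s ⊆ fac f t → ∃[ s′ ] s ≡ fac f s′ × s′ ⊆ t
⊆-fac f {s} sub with uninsert f s
... | s′ , outside , refl = s′ , refl , insertAt-⊆⁻ f sub
... | s′ , inside  , refl with () ← insertAt-∈⁻ f sub refl

∣fac∣ : ∀ f (s : Subset n) → ∣ fac f s ∣ ≡ ∣ s ∣
∣fac∣ zero    s             = refl
∣fac∣ (suc f) (inside  ∷ s) = cong suc (∣fac∣ f s)
∣fac∣ (suc f) (outside ∷ s) = ∣fac∣ f s

corank-one : (s : Subset (suc n)) → ∣ s ∣ ≡ n → ∃[ f ] s ≡ fac f ⊤
corank-one         (outside ∷ s) eq = zero , cong (outside ∷_) (∣p∣≡n⇒p≡⊤ eq)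
corank-one {suc n} (inside  ∷ s) eq with corank-one s (ℕ.suc-injective eq)
... | f , refl = suc f , refl

-- The vertex `r` is counted inside the facet, so that a facet of a d-simplex has its ridges
-- numbered by `Fin d`; these numbers are the labels.
corank-two : (s : Subset (suc (suc n))) → suc ∣ s ∣ ≡ suc n → ∀ {f} → s ⊆ fac f ⊤ →
             ∃[ r ] s ≡ fac f (fac r ⊤)
corank-two s eq {f} sub with ⊆-fac f sub
... | s′ , refl , _ with corank-one s′ (trans (sym (∣fac∣ f s′)) (ℕ.suc-injective eq))
... | r , refl = r , refl

fac-∌ : ∀ f {s t : Subset n} {b} → insertAt s f b ⊆ fac f t → b ≡ outside
fac-∌ f {b = outside} sub = refl
fac-∌ f {b = inside}  sub = sym (insertAt-∈⁻ f sub refl)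

-- The ridge misses exactly the vertices `f` and `punchIn f r`. Any other `g` is a vertex of it, so
-- the facet opposite to `g` does not contain it.
facets-over-corank-two : ∀ (f g : Fin (suc (suc n))) {r} → fac f (fac r ⊤) ⊆ fac g ⊤ →
                         g ≡ f ⊎ g ≡ punchIn f r
facets-over-corank-two f g {r} sub with f Fin.≟ g
... | yes f≡g = inj₁ (sym f≡g)
... | no  f≢g with Fin.punchOut f≢g Fin.≟ r
...   | yes eq = inj₂ (trans (sym (Fin.punchIn-punchOut f≢g)) (cong (punchIn f) eq))
...   | no neq = contradiction (trans (sym outside-g) inside-g) (λ ())
  where
  k = Fin.punchOut (neq ∘ sym)
  inside-g : lookup (fac f (fac r ⊤)) g ≡ inside
  inside-g = begin
    lookup (fac f (fac r ⊤)) g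
      ≡⟨ cong (lookup (fac f (fac r ⊤))) (Fin.punchIn-punchOut f≢g) ⟨
    lookup (fac f (fac r ⊤)) (punchIn f (Fin.punchOut f≢g))
      ≡⟨ Vec.insertAt-punchIn (fac r ⊤) f outside _ ⟩
    lookup (fac r ⊤) (Fin.punchOut f≢g)
      ≡⟨ cong (lookup (fac r ⊤)) (Fin.punchIn-punchOut (neq ∘ sym)) ⟨
    lookup (fac r ⊤) (punchIn r k)
      ≡⟨ Vec.insertAt-punchIn ⊤ r outside _ ⟩
    lookup ⊤ k
      ≡⟨ Vec.[]=⇒lookup (∈⊤ {x = k}) ⟩
    inside ∎
    where open ≡-Reasoning
  outside-g : lookup (fac f (fac r ⊤)) g ≡ outside
  outside-g with lookup (fac f (fac r ⊤)) g in eq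
  ... | outside = refl
  ... | inside  = trans (sym (Vec.[]=⇒lookup (sub (Vec.lookup⇒[]= g _ eq)))) (Vec.insertAt-lookup ⊤ g outside)

-- This starts the invariant `atMostTwo` for a single simplex and supplies it for the simplex added
-- in an attachment.
at-most-two-facets : ∀ (s : Subset (suc (suc n))) → suc ∣ s ∣ ≡ suc n → ∀ {f g h} →
  s ⊆ fac f ⊤ → s ⊆ fac g ⊤ → s ⊆ fac h ⊤ → f ≡ g ⊎ g ≡ h ⊎ f ≡ h
at-most-two-facets s eq {f} {g} {h} sf sg sh with corank-two s eq sf
... | r , refl with facets-over-corank-two f g sg | facets-over-corank-two f h sh
...   | inj₁ g≡f | _        = inj₁ (sym g≡f)
...   | _        | inj₁ h≡f = inj₂ (inj₂ (sym h≡f))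
...   | inj₂ g≡  | inj₂ h≡  = inj₂ (inj₁ (trans g≡ (sym h≡)))

-- Order embeddings of boolean lattices

record Embedding (θ : Subset m → Subset n) : Set where
  field
    mono   : ∀ {s t} → s ⊆ t → θ s ⊆ θ t
    cancel : ∀ {s t} → θ s ⊆ θ t → s ⊆ t

-- Only the vertex r lies outside the facet on which the two maps agree.
embedding-determined : ∀ {θ θ′ : Subset (suc n) → Subset m} r →
  Embedding θ → Embedding θ′ → (∀ t → ∃[ s ] θ′ t ≡ θ s) →
  (∀ w → θ (fac r w) ≡ θ′ (fac r w)) → ∀ t → θ t ≡ θ′ t
embedding-determined {n} {m} {θ} {θ′} r emb emb′ image agree t with image t
... | s , θ′t≡θs with uninsert r t | uninsert r s
... | w , b , refl | w′ , b′ , refl = trans (cong θ t≡s) (sym θ′t≡θs)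
  where
  module E = Embedding emb
  module E′ = Embedding emb′
  below : ∀ v b → fac r v ⊆ insertAt v r b
  below v b = insertAt-⊆ r ⊆-refl (λ ())
  -- Faces avoiding `r` have the same image under both maps, so the parts of `t` and `s` away from
  -- `r` contain each other; `compare` then decides about `r` itself.
  w⊆w′ : w ⊆ w′
  w⊆w′ = insertAt-⊆⁻ r (E.cancel (subst₂ _⊆_ (sym (agree w)) θ′t≡θs (E′.mono (below w b))))
  w′⊆w : w′ ⊆ w
  w′⊆w = insertAt-⊆⁻ r (E′.cancel (subst₂ _⊆_ (agree w′) (sym θ′t≡θs) (E.mono (below w′ b′))))
  compare : ∀ b b′ → θ′ (insertAt w r b) ≡ θ (insertAt w r b′) → b ≡ b′
  compare inside  inside  _  = refl
  compare outside outside _  = refl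
  compare inside  outside eq = fac-∌ r (E′.cancel (⊆-reflexive (trans eq (agree w))))
  compare outside inside  eq = sym (fac-∌ r (E.cancel (⊆-reflexive (trans (sym eq) (sym (agree w))))))
  w≡w′ : w ≡ w′
  w≡w′ = ⊆-antisym w⊆w′ w′⊆w
  t≡s : insertAt w r b ≡ insertAt w′ r b′
  t≡s with refl ← w≡w′ = cong (insertAt w r) (compare b b′ θ′t≡θs)

⊆∧∣≡∣⇒≡ : {p q : Subset n} → p ⊆ q → ∣ p ∣ ≡ ∣ q ∣ → p ≡ q
⊆∧∣≡∣⇒≡ {p = []}          {[]}          sub eq = refl
⊆∧∣≡∣⇒≡ {p = outside ∷ p} {outside ∷ q} sub eq = cong (outside ∷_) (⊆∧∣≡∣⇒≡ (drop-∷-⊆ sub) eq)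
⊆∧∣≡∣⇒≡ {p = inside  ∷ p} {inside  ∷ q} sub eq =
  cong (inside ∷_) (⊆∧∣≡∣⇒≡ (drop-∷-⊆ sub) (ℕ.suc-injective eq))
⊆∧∣≡∣⇒≡ {p = inside  ∷ p} {outside ∷ q} sub eq with () ← sub here
⊆∧∣≡∣⇒≡ {p = outside ∷ p} {inside  ∷ q} sub eq =
  contradiction (p⊆q⇒∣p∣≤∣q∣ (drop-∷-⊆ sub)) (ℕ.<⇒≱ (ℕ.≤-reflexive (sym eq)))

-- Removing one vertex from `⊤` makes the image strictly smaller, because an embedding is injective.
embedding⇒≤∣θ⊤∣ : ∀ {θ : Subset m → Subset n} → Embedding θ → m ≤ ∣ θ ⊤ ∣
embedding⇒≤∣θ⊤∣ {zero}          emb = ℕ.z≤n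
embedding⇒≤∣θ⊤∣ {suc m} {θ = θ} emb =
  ℕ.≤-<-trans (embedding⇒≤∣θ⊤∣ emb′) (ℕ.≤∧≢⇒< (p⊆q⇒∣p∣≤∣q∣ θ⊤′⊆θ⊤) ∣θ⊤′∣≢∣θ⊤∣)
  where
  open Embedding emb
  emb′ : Embedding (θ ∘ (outside ∷_))
  emb′ = record { mono = λ s⊆t → mono (s⊆s s⊆t) ; cancel = λ sub → drop-∷-⊆ (cancel sub) }
  θ⊤′⊆θ⊤ : θ (outside ∷ ⊤) ⊆ θ ⊤
  θ⊤′⊆θ⊤ = mono (⊆-max _)
  ∣θ⊤′∣≢∣θ⊤∣ : ∣ θ (outside ∷ ⊤) ∣ ≢ ∣ θ ⊤ ∣
  ∣θ⊤′∣≢∣θ⊤∣ eq with () ← cancel (⊆-reflexive (sym (⊆∧∣≡∣⇒≡ θ⊤′⊆θ⊤ eq))) here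

embedding⇒≤ : ∀ {θ : Subset m → Subset n} → Embedding θ → m ≤ n
embedding⇒≤ {θ = θ} emb = ℕ.≤-trans (embedding⇒≤∣θ⊤∣ emb) (∣p∣≤n (θ ⊤))

-- Renumbers the vertices of `s`: an isomorphism from a standard boolean lattice onto the faces of
-- `s`, so that `embedding⇒≤` can compare faces of different simplices.
spread : (s : Subset n) → Subset ∣ s ∣ → Subset n
spread []            t       = []
spread (inside  ∷ s) (b ∷ t) = b ∷ spread s t
spread (outside ∷ s) t       = outside ∷ spread s t

spread-⊆ : (s : Subset n) (t : Subset ∣ s ∣) → spread s t ⊆ s
spread-⊆ (inside  ∷ s) (inside  ∷ t) = in⊆in (spread-⊆ s t)
spread-⊆ (inside  ∷ s) (outside ∷ t) = out⊆ (spread-⊆ s t)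
spread-⊆ (outside ∷ s) t             = out⊆ (spread-⊆ s t)

spread-embedding : (s : Subset n) → Embedding (spread s)
spread-embedding s = record { mono = mono s ; cancel = cancel s }
  where
  mono : ∀ {n} (s : Subset n) {t u} → t ⊆ u → spread s t ⊆ spread s u
  mono []            _ ()
  mono (outside ∷ s) t⊆u = s⊆s (mono s t⊆u)
  mono (inside  ∷ s) {outside ∷ t} {_ ∷ u} t⊆u = out⊆ (mono s (drop-∷-⊆ t⊆u))
  mono (inside  ∷ s) {inside  ∷ t} {_ ∷ u} t⊆u with here ← t⊆u here = in⊆in (mono s (drop-∷-⊆ t⊆u))
  cancel : ∀ {n} (s : Subset n) {t u} → spread s t ⊆ spread s u → t ⊆ u
  cancel []            _ ()
  cancel (outside ∷ s) sub = cancel s (drop-∷-⊆ sub)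
  cancel (inside  ∷ s) {outside ∷ t} {_ ∷ u} sub = out⊆ (cancel s (drop-∷-⊆ sub))
  cancel (inside  ∷ s) {inside  ∷ t} {_ ∷ u} sub with here ← sub here = in⊆in (cancel s (drop-∷-⊆ sub))

spread-surjective : ∀ {s t : Subset n} → t ⊆ s → ∃[ u ] spread s u ≡ t
spread-surjective {s = []}          {[]}          sub = [] , refl
spread-surjective {s = inside  ∷ s} {b ∷ t}       sub =
  let u , eq = spread-surjective (drop-∷-⊆ sub) in b ∷ u , cong (b ∷_) eq
spread-surjective {s = outside ∷ s} {outside ∷ t} sub =
  let u , eq = spread-surjective (drop-∷-⊆ sub) in u , cong (outside ∷_) eq
spread-surjective {s = outside ∷ s} {inside  ∷ t} sub with () ← sub here

vecToFin : ∀ {a} {A : Set a} → (A → Fin m) → Vec A n → Fin (m ^ n)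
vecToFin f xs = funToFin (f ∘ lookup xs)

vecToFin-injective : ∀ {a} {A : Set a} {f : A → Fin m} → (∀ {x y} → f x ≡ f y → x ≡ y) →
                     {xs ys : Vec A n} → vecToFin f xs ≡ vecToFin f ys → xs ≡ ys
vecToFin-injective {f = f} f-inj {xs} {ys} eq = begin
  xs                       ≡⟨ Vec.tabulate∘lookup xs ⟨
  Vec.tabulate (lookup xs) ≡⟨ Vec.tabulate-cong same ⟩
  Vec.tabulate (lookup ys) ≡⟨ Vec.tabulate∘lookup ys ⟩
  ys                       ∎
  where
  open ≡-Reasoning
  same : ∀ i → lookup xs i ≡ lookup ys i
  same i = f-inj (trans (sym (Fin.finToFun-funToFin (f ∘ lookup xs) i))
    (trans (cong (λ k → finToFun k i) eq) (Fin.finToFun-funToFin (f ∘ lookup ys) i)))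

-- Trees of simplices

++-injective : ∀ {a} {A : Set a} {as bs : List A} {cs ds} → length as ≡ length bs →
               as ++ cs ≡ bs ++ ds → as ≡ bs × cs ≡ ds
++-injective {as = []}     {[]}     _   eq = refl , eq
++-injective {as = a ∷ as} {b ∷ bs} len eq with List.∷-injective eq
... | refl , eq′ = map₁ (cong (a ∷_)) (++-injective (ℕ.suc-injective len) eq′)

data Tree (d : ℕ) : Set where
  leaf : Tree d
  node : Vec (Tree d) d → Tree d

data Status : Set where
  absent leaf node : Status

module _ {d : ℕ} where

  Word : Set
  Word = List (Fin d)

  _≟ʷ_ : DecidableEquality Word
  _≟ʷ_ = List.≡-dec Fin._≟_

  look : Tree d → Word → Status
  look leaf      []      = leaf
  look leaf      (i ∷ w) = absent
  look (node ts) []      = node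
  look (node ts) (i ∷ w) = look (lookup ts i) w

  look-parent : ∀ t w {i} → look t (w ∷ʳ i) ≢ absent → look t w ≡ node
  look-parent leaf      []      present = contradiction refl present
  look-parent leaf      (j ∷ w) present = contradiction refl present
  look-parent (node ts) []      present = refl
  look-parent (node ts) (j ∷ w) present = look-parent (lookup ts j) w present

  look-root : ∀ t → look t [] ≢ absent
  look-root leaf     ()
  look-root (node _) ()

  look-child : ∀ t w {i} → look t w ≡ node → look t (w ∷ʳ i) ≢ absent
  look-child (node ts) []      {i} eq = look-root (lookup ts i)
  look-child (node ts) (j ∷ w) eq = look-child (lookup ts j) w eq

  bud : Tree d
  bud = node (replicate d leaf)

  -- Meant for words with `look t w ≡ leaf`, as the lemmas about it assume; the values at other
  -- words are defaults.
  grow : Tree d → Word → Tree d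
  grow leaf      _       = bud
  grow (node ts) []      = node ts
  grow (node ts) (i ∷ w) = node (ts [ i ]≔ grow (lookup ts i) w)

  mutual
    nodes leaves : Tree d → ℕ
    nodes leaf      = 0
    nodes (node ts) = suc (nodes* ts)
    leaves leaf      = 1
    leaves (node ts) = leaves* ts

    nodes* leaves* : ∀ {k} → Vec (Tree d) k → ℕ
    nodes* []       = 0
    nodes* (t ∷ ts) = nodes t + nodes* ts
    leaves* []       = 0
    leaves* (t ∷ ts) = leaves t + leaves* ts

  nodes*-replicate : ∀ k → nodes* (replicate k leaf) ≡ 0
  nodes*-replicate zero    = refl
  nodes*-replicate (suc k) = nodes*-replicate k

  nodes-update : ∀ {k} (ts : Vec (Tree d) k) i {t} → nodes t ≡ suc (nodes (lookup ts i)) →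
                 nodes* (ts [ i ]≔ t) ≡ suc (nodes* ts)
  nodes-update (t ∷ ts) zero    eq = cong (_+ nodes* ts) eq
  nodes-update (t ∷ ts) (suc i) eq =
    trans (cong (nodes t +_) (nodes-update ts i eq)) (ℕ.+-suc (nodes t) (nodes* ts))

  nodes-grow : ∀ t w → look t w ≡ leaf → nodes (grow t w) ≡ suc (nodes t)
  nodes-grow leaf      []      eq = cong suc (nodes*-replicate d)
  nodes-grow (node ts) (i ∷ w) eq = cong suc (nodes-update ts i (nodes-grow (lookup ts i) w eq))

  look-grow-here : ∀ t w → look t w ≡ leaf → look (grow t w) w ≡ node
  look-grow-here leaf      []      eq = refl
  look-grow-here (node ts) (i ∷ w) eq
    rewrite Vec.lookup∘update i ts (grow (lookup ts i) w) = look-grow-here (lookup ts i) w eq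

  look-grow-child : ∀ t w {i} → look t w ≡ leaf → look (grow t w) (w ∷ʳ i) ≡ leaf
  look-grow-child leaf      []      {i} eq = cong (λ t → look t []) (Vec.lookup-replicate i leaf)
  look-grow-child (node ts) (i ∷ w) eq
    rewrite Vec.lookup∘update i ts (grow (lookup ts i) w) = look-grow-child (lookup ts i) w eq

  look-grow-other : ∀ t w v → look t w ≡ leaf → v ≢ w → (∀ i → v ≢ w ∷ʳ i) →
                    look (grow t w) v ≡ look t v
  look-grow-other leaf      []      []          eq v≢ v≢∷ʳ = contradiction refl v≢
  look-grow-other leaf      []      (j ∷ [])    eq v≢ v≢∷ʳ = contradiction refl (v≢∷ʳ j)
  look-grow-other leaf      []      (j ∷ k ∷ v) eq v≢ v≢∷ʳ =
    cong (λ t → look t (k ∷ v)) (Vec.lookup-replicate j leaf)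
  look-grow-other (node ts) (i ∷ w) []          eq v≢ v≢∷ʳ = refl
  look-grow-other (node ts) (i ∷ w) (j ∷ v)     eq v≢ v≢∷ʳ with j Fin.≟ i
  ... | yes refl rewrite Vec.lookup∘update i ts (grow (lookup ts i) w) =
    look-grow-other (lookup ts i) w v eq (v≢ ∘ cong (i ∷_)) (λ k → v≢∷ʳ k ∘ cong (i ∷_))
  ... | no j≢i rewrite Vec.lookup∘update′ j≢i ts (grow (lookup ts i) w) = refl

  mutual
    shape : Tree d → List Bool
    shape leaf      = false ∷ []
    shape (node ts) = true ∷ shape* ts

    shape* : ∀ {k} → Vec (Tree d) k → List Bool
    shape* []       = []
    shape* (t ∷ ts) = shape t ++ shape* ts

  mutual
    length-shape : ∀ t → length (shape t) ≡ nodes t + leaves t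
    length-shape leaf      = refl
    length-shape (node ts) = cong suc (length-shape* ts)

    length-shape* : ∀ {k} (ts : Vec (Tree d) k) → length (shape* ts) ≡ nodes* ts + leaves* ts
    length-shape* []       = refl
    length-shape* (t ∷ ts) = begin
      length (shape t ++ shape* ts)          ≡⟨ List.length-++ (shape t) ⟩
      length (shape t) + length (shape* ts)  ≡⟨ cong₂ _+_ (length-shape t) (length-shape* ts) ⟩
      (nodes t + leaves t) + (nodes* ts + leaves* ts) ≡⟨ interchange (nodes t) (leaves t) (nodes* ts) (leaves* ts) ⟩
      (nodes t + nodes* ts) + (leaves t + leaves* ts) ∎
      where
      open ≡-Reasoning
      interchange : ∀ a b c d → (a + b) + (c + d) ≡ (a + c) + (b + d)
      interchange = solve-∀

  mutual
    -- The preorder word of a tree is self-delimiting. The tails make the induction work, since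
    -- within `shape*` the word of a tree is followed by those of its siblings.
    shape-injective : ∀ t u {bs cs} → shape t ++ bs ≡ shape u ++ cs → t ≡ u × bs ≡ cs
    shape-injective leaf      leaf      eq = refl , List.∷-injectiveʳ eq
    shape-injective (node ts) (node us) eq = map₁ (cong node) (shape*-injective ts us (List.∷-injectiveʳ eq))

    shape*-injective : ∀ {k} (ts us : Vec (Tree d) k) {bs cs} →
                       shape* ts ++ bs ≡ shape* us ++ cs → ts ≡ us × bs ≡ cs
    shape*-injective []       []       eq = refl , eq
    shape*-injective (t ∷ ts) (u ∷ us) {bs} {cs} eq
      with shape-injective t u (trans (sym (List.++-assoc (shape t) (shape* ts) bs))
                                 (trans eq (List.++-assoc (shape u) (shape* us) cs)))
    ... | refl , eq′ = map₁ (cong (t ∷_)) (shape*-injective ts us eq′)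

  module _ {L : Set} where

    mutual
      labels : Tree d → (Word → L) → List L
      labels leaf      lab = lab [] ∷ []
      labels (node ts) lab = labels* ts (λ i w → lab (i ∷ w))

      labels* : ∀ {k} → Vec (Tree d) k → (Fin k → Word → L) → List L
      labels* []       lab = []
      labels* (t ∷ ts) lab = labels t (lab zero) ++ labels* ts (lab ∘ suc)

    mutual
      length-labels : ∀ t lab → length (labels t lab) ≡ leaves t
      length-labels leaf      lab = refl
      length-labels (node ts) lab = length-labels* ts _

      length-labels* : ∀ {k} (ts : Vec (Tree d) k) lab → length (labels* ts lab) ≡ leaves* ts
      length-labels* []       lab = refl
      length-labels* (t ∷ ts) lab = trans (List.length-++ (labels t (lab zero)))
        (cong₂ _+_ (length-labels t _) (length-labels* ts _))

    mutual
      -- Both lists belong to the same tree, so the parts for each subtree have equal lengths and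
      -- the concatenations split in the same places.
      labels-injective : ∀ t {lab lab′} → labels t lab ≡ labels t lab′ →
                         ∀ w → look t w ≡ leaf → lab w ≡ lab′ w
      labels-injective leaf      eq []      _  = List.∷-injectiveˡ eq
      labels-injective (node ts) eq (i ∷ w) l  = labels*-injective ts eq i w l

      labels*-injective : ∀ {k} (ts : Vec (Tree d) k) {lab lab′} → labels* ts lab ≡ labels* ts lab′ →
                          ∀ i w → look (lookup ts i) w ≡ leaf → lab i w ≡ lab′ i w
      labels*-injective (t ∷ ts) {lab} {lab′} eq i w l
        with ++-injective {as = labels t (lab zero)} {labels t (lab′ zero)}
               (trans (length-labels t _) (sym (length-labels t _))) eq | i
      ... | eq₀ , _  | zero  = labels-injective t eq₀ w l
      ... | _ , eq₁  | suc j = labels*-injective ts eq₁ j w l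

module _ {e : ℕ} where

  private
    d : ℕ
    d = suc e

  mutual
    -- Each node takes the place of one leaf and brings `suc e` new ones, a gain of `e`.
    leaves-nodes : (t : Tree d) → leaves t ≡ e * nodes t + 1
    leaves-nodes leaf      = cong (_+ 1) (sym (ℕ.*-zeroʳ e))
    leaves-nodes (node ts) = trans (leaves*-nodes* ts) (step e (nodes* ts))
      where
      step : ∀ e n → e * n + suc e ≡ e * suc n + 1
      step = solve-∀

    leaves*-nodes* : ∀ {k} (ts : Vec (Tree d) k) → leaves* ts ≡ e * nodes* ts + k
    leaves*-nodes* []       = sym (trans (ℕ.+-identityʳ _) (ℕ.*-zeroʳ e))
    leaves*-nodes* {suc k} (t ∷ ts) = trans (cong₂ _+_ (leaves-nodes t) (leaves*-nodes* ts))
                                    (step e (nodes t) (nodes* ts) k)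
      where
      step : ∀ e m n k → e * m + 1 + (e * n + k) ≡ e * (m + n) + suc k
      step = solve-∀

-- The addresses of the simplices and of the facets in a tree of d-simplices.  Vertices
-- are coloured by Fin (suc d) so that two simplices glued along a facet agree on it.
-- The facet a separates the simplices parent a and beyond a and misses the colour
-- color a; beyond a exists only if a is not on the boundary.  The facet of the root
-- that misses the colour zero is opposite, all other facets of u are of the form
-- u ▹ i or, if u = beyond a, equal to a.
mutual
  data Simplex (d : ℕ) : Set where
    root   : Simplex d
    beyond : Facet d → Simplex d

  data Facet (d : ℕ) : Set where
    opposite : Facet d
    _▹_      : Simplex d → Fin d → Facet d

module _ {d : ℕ} where

  mutual
    parent : Facet d → Simplex d
    parent opposite = root
    parent (u ▹ i)  = u

    -- The root counts as entered through `opposite`, so that `punchIn (entry u)` enumerates the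
    -- remaining facets of every simplex alike.
    entry : Simplex d → Fin (suc d)
    entry root       = zero
    entry (beyond a) = color a

    color : Facet d → Fin (suc d)
    color opposite = zero
    color (u ▹ i)  = punchIn (entry u) i

  parent≢beyond : ∀ a → parent a ≢ beyond a
  parent≢beyond opposite ()
  parent≢beyond (u ▹ i)  ()

  mutual
    _≟ˢ_ : DecidableEquality (Simplex d)
    root     ≟ˢ root     = yes refl
    root     ≟ˢ beyond _ = no λ ()
    beyond _ ≟ˢ root     = no λ ()
    beyond a ≟ˢ beyond b = map′ (cong beyond) (λ { refl → refl }) (a ≟ᶠ b)

    _≟ᶠ_ : DecidableEquality (Facet d)
    opposite ≟ᶠ opposite = yes refl
    opposite ≟ᶠ (_ ▹ _)  = no λ ()
    (_ ▹ _)  ≟ᶠ opposite = no λ ()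
    (u ▹ i)  ≟ᶠ (v ▹ j)  = map′ (λ { (refl , refl) → refl }) (λ { refl → refl , refl }) (u ≟ˢ v ×-dec i Fin.≟ j)

  facet-unique : ∀ a b → parent a ≡ parent b → color a ≡ color b → a ≡ b
  facet-unique opposite      opposite      _    _  = refl
  facet-unique opposite      (.root ▹ j)   refl ()
  facet-unique (.root ▹ i)   opposite      refl ()
  facet-unique (u ▹ i)       (.u ▹ j)      refl eq = cong (u ▹_) (Fin.punchIn-injective (entry u) i j eq)

  facet-cases : ∀ u f → (∃[ a ] u ≡ beyond a × f ≡ color a) ⊎ (∃[ a ] parent a ≡ u × color a ≡ f)
  facet-cases root       zero = inj₂ (opposite , refl , refl)
  facet-cases root (suc f)    = inj₂ (root ▹ f , refl , refl)
  facet-cases (beyond a) f with color a Fin.≟ f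
  ... | yes eq  = inj₁ (a , refl , sym eq)
  ... | no  neq = inj₂ (beyond a ▹ Fin.punchOut neq , refl , Fin.punchIn-punchOut neq)

  mutual
    -- A facet and the simplex beyond it share their location, which holds a leaf if the facet is on
    -- the boundary and a node if that simplex exists. The bit selects the side of `opposite`:
    -- `true` is the side of the root.
    locˢ : Simplex d → Bool × Word {d}
    locˢ root       = true , []
    locˢ (beyond a) = loc a

    loc : Facet d → Bool × Word {d}
    loc opposite = false , []
    loc (u ▹ i)  = proj₁ (locˢ u) , proj₂ (locˢ u) ∷ʳ i

  ∷ʳ≢[] : ∀ (w : Word {d}) {i} → w ∷ʳ i ≢ []
  ∷ʳ≢[] []      ()
  ∷ʳ≢[] (_ ∷ _) ()

  locˢ-injective : ∀ u v → locˢ u ≡ locˢ v → u ≡ v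
  loc-injective : ∀ a b → loc a ≡ loc b → a ≡ b
  loc≢root : ∀ a → loc a ≢ (true , [])

  locˢ-injective root       root       eq = refl
  locˢ-injective root       (beyond b) eq = contradiction (sym eq) (loc≢root b)
  locˢ-injective (beyond a) root       eq = contradiction eq (loc≢root a)
  locˢ-injective (beyond a) (beyond b) eq = cong beyond (loc-injective a b eq)

  loc-injective opposite opposite eq = refl
  loc-injective opposite (v ▹ j)  eq = contradiction (sym (cong proj₂ eq)) (∷ʳ≢[] (proj₂ (locˢ v)))
  loc-injective (u ▹ i) opposite  eq = contradiction (cong proj₂ eq) (∷ʳ≢[] (proj₂ (locˢ u)))
  loc-injective (u ▹ i) (v ▹ j) eq
    with List.∷ʳ-injective (proj₂ (locˢ u)) (proj₂ (locˢ v)) (cong proj₂ eq)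
  ... | words , refl = cong (_▹ i) (locˢ-injective u v (cong₂ _,_ (cong proj₁ eq) words))

  loc≢root opposite ()
  loc≢root (u ▹ i)  eq = ∷ʳ≢[] (proj₂ (locˢ u)) (cong proj₂ eq)

-- Pairs of trees and their growth

record Forest (d : ℕ) : Set where
  constructor _⊹_
  field
    inner outer : Tree d

  infix 9 _!_
  _!_ : Bool → Tree d
  _!_ true  = inner
  _!_ false = outer

open Forest using (_!_)

module _ {d : ℕ} where

  size : Forest d → ℕ
  size F = nodes (F ! true) + nodes (F ! false)

  status : Forest d → Bool × Word {d} → Status
  status F (b , w) = look (F ! b) w

  record IsSimplex (F : Forest d) (u : Simplex d) : Set where
    constructor simplex
    field is-node : status F (locˢ u) ≡ node

  record IsBoundary (F : Forest d) (a : Facet d) : Set where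
    constructor boundary
    field is-leaf : status F (loc a) ≡ leaf

  boundary-≢-interior : ∀ {F a} → IsBoundary F a → ¬ IsSimplex F (beyond a)
  boundary-≢-interior (boundary l) (simplex n) with () ← trans (sym l) n

  parent-simplex : ∀ {F} → IsSimplex F root → ∀ a → status F (loc a) ≢ absent → IsSimplex F (parent a)
  parent-simplex r opposite present = r
  parent-simplex {F} r (u ▹ i)  present = simplex (look-parent (F ! (proj₁ (locˢ u))) (proj₂ (locˢ u)) present)

  parent-of-boundary : ∀ {F} → IsSimplex F root → ∀ {a} → IsBoundary F a → IsSimplex F (parent a)
  parent-of-boundary r {a} (boundary l) = parent-simplex r a λ eq → case trans (sym l) eq of λ ()

  parent-of-interior : ∀ {F} → IsSimplex F root → ∀ {a} → IsSimplex F (beyond a) → IsSimplex F (parent a)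
  parent-of-interior r {a} (simplex n) = parent-simplex r a λ eq → case trans (sym n) eq of λ ()

  boundary-or-interior : ∀ {F a} → IsSimplex F (parent a) → IsBoundary F a ⊎ IsSimplex F (beyond a)
  boundary-or-interior {F} {a} p with status F (loc a) in eq
  ... | leaf   = inj₁ (boundary eq)
  ... | node   = inj₂ (simplex eq)
  ... | absent = contradiction eq (present a p)
    where
    present : ∀ a → IsSimplex F (parent a) → status F (loc a) ≢ absent
    present opposite _           = look-root (F ! false)
    present (u ▹ i)  (simplex n) = look-child (F ! (proj₁ (locˢ u))) (proj₂ (locˢ u)) n

  -- The root alone: the leaves of `bud` are its facets `root ▹ i`, the outer leaf is `opposite`.
  initial : Forest d
  initial = bud ⊹ leaf

  initial-only-root : ∀ {u} → IsSimplex initial u → u ≡ root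
  initial-only-root {root}            _  = refl
  initial-only-root {beyond opposite} (simplex ())
  initial-only-root {beyond (u ▹ i)} s
    with initial-only-root {u} (parent-of-interior (simplex refl) s)
  ... | refl with () ← trans (sym (look-grow-child leaf [] {i} refl)) (IsSimplex.is-node s)

  extendAt : Forest d → Bool × Word {d} → Forest d
  extendAt (t ⊹ u) (true  , w) = grow t w ⊹ u
  extendAt (t ⊹ u) (false , w) = t ⊹ grow u w

  extendAt-here : ∀ F b w → extendAt F (b , w) ! b ≡ grow (F ! b) w
  extendAt-here F true  w = refl
  extendAt-here F false w = refl

  extendAt-there : ∀ F {b b′} w → b′ ≢ b → extendAt F (b , w) ! b′ ≡ F ! b′
  extendAt-there F {true}  {false} w _   = refl
  extendAt-there F {false} {true}  w _   = refl
  extendAt-there F {true}  {true}  w b≢b = contradiction refl b≢b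
  extendAt-there F {false} {false} w b≢b = contradiction refl b≢b

  extend : Forest d → Facet d → Forest d
  extend F a = extendAt F (loc a)

  size-extendAt : ∀ F l → status F l ≡ leaf → size (extendAt F l) ≡ suc (size F)
  size-extendAt (t ⊹ u) (true  , w) l = cong (_+ nodes u) (nodes-grow t w l)
  size-extendAt (t ⊹ u) (false , w) l = trans (cong (nodes t +_) (nodes-grow u w l)) (ℕ.+-suc _ _)

  module Extend (F : Forest d) (a : Facet d) (bd : IsBoundary F a) where

    open IsBoundary bd

    private
      F′ = extend F a
      b₀ = proj₁ (loc a)
      w₀ = proj₂ (loc a)

    size-extend : size F′ ≡ suc (size F)
    size-extend = size-extendAt F (loc a) is-leaf

    beyond-boundary? : ∀ b → (∃[ i ] b ≡ beyond a ▹ i) ⊎ (∀ i → b ≢ beyond a ▹ i)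
    beyond-boundary? opposite = inj₂ λ i ()
    beyond-boundary? (v ▹ i) with v ≟ˢ beyond a
    ... | yes refl = inj₁ (i , refl)
    ... | no  neq  = inj₂ λ { j refl → neq refl }

    status-other : ∀ l → l ≢ loc a → (∀ i → l ≢ loc (beyond a ▹ i)) → status F′ l ≡ status F l
    status-other (b , w) l≢ l≢∷ʳ with b Bool.≟ b₀
    ... | no  b≢   = cong (λ t → look t w) (extendAt-there F w₀ b≢)
    ... | yes refl = trans (cong (λ t → look t w) (extendAt-here F b w₀))
      (look-grow-other (F ! b) w₀ w is-leaf (l≢ ∘ cong (b ,_)) (λ i → l≢∷ʳ i ∘ cong (b ,_)))

    status-old-facet : ∀ b → b ≢ a → (∀ i → b ≢ beyond a ▹ i) → status F′ (loc b) ≡ status F (loc b)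
    status-old-facet b b≢a not-new = status-other (loc b) (b≢a ∘ loc-injective b a)
      (λ i → not-new i ∘ loc-injective b (beyond a ▹ i))

    new-simplex : IsSimplex F′ (beyond a)
    new-simplex = simplex (trans (cong (λ t → look t w₀) (extendAt-here F b₀ w₀))
      (look-grow-here (F ! b₀) w₀ is-leaf))

    new-boundary : ∀ i → IsBoundary F′ (beyond a ▹ i)
    new-boundary i = boundary (trans (cong (λ t → look t (w₀ ∷ʳ i)) (extendAt-here F b₀ w₀))
      (look-grow-child (F ! b₀) w₀ is-leaf))

    old-simplex : ∀ {u} → IsSimplex F u → IsSimplex F′ u
    old-simplex {u} (simplex n) = simplex (trans (status-other (locˢ u) u≢a u≢new) n)
      where
      u≢a : locˢ u ≢ loc a
      u≢a eq with () ← trans (sym is-leaf) (trans (cong (status F) (sym eq)) n)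
      present : ∀ {l} → locˢ u ≡ l → status F l ≢ absent
      present refl abs with () ← trans (sym n) abs
      u≢new : ∀ i → locˢ u ≢ loc (beyond a ▹ i)
      u≢new i eq with () ← trans (sym (look-parent (F ! b₀) w₀ (present eq))) is-leaf

    simplex-cases : ∀ {u} → IsSimplex F′ u → IsSimplex F u ⊎ u ≡ beyond a
    simplex-cases {root} (simplex n) =
      inj₁ (simplex (trans (sym (status-other (locˢ root) (loc≢root a ∘ sym) (λ i → loc≢root (beyond a ▹ i) ∘ sym))) n))
    simplex-cases {beyond b} s@(simplex n) with b ≟ᶠ a | beyond-boundary? b
    ... | yes refl | _               = inj₂ refl
    ... | no  b≢a  | inj₁ (i , refl) = contradiction s (boundary-≢-interior (new-boundary i))
    ... | no  b≢a  | inj₂ not-new    = inj₁ (simplex (trans (sym (status-old-facet b b≢a not-new)) n))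

    boundary-cases : ∀ {b} → IsBoundary F′ b → (IsBoundary F b × b ≢ a) ⊎ (∃[ i ] b ≡ beyond a ▹ i)
    boundary-cases {b} bd′@(boundary l) with b ≟ᶠ a | beyond-boundary? b
    ... | yes refl | _            = contradiction new-simplex (boundary-≢-interior bd′)
    ... | no  _    | inj₁ new     = inj₂ new
    ... | no  b≢a  | inj₂ not-new = inj₁ (boundary (trans (sym (status-old-facet b b≢a not-new)) l) , b≢a)

-- Face posets covered by charts, and their quotients

-- Each `c u` is an isomorphism from the face lattice of the simplex `u` onto the interval below
-- `c u ⊤`, and these intervals cover `P`. At addresses outside `IsS` the values of `c` are
-- arbitrary.
record Chart {d} (IsS : Simplex d → Set) (P : Poset 0ℓ 0ℓ 0ℓ)
             (c : Simplex d → Subset (suc d) → Poset.Carrier P) : Set where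
  open Poset P using (Carrier; _≈_; reflexive; antisym; ≤-respˡ-≈; ≤-respʳ-≈; module Eq)
    renaming (_≤_ to _≼_; trans to ≼-trans)
  field
    mono   : ∀ {u s t} → IsS u → s ⊆ t → c u s ≼ c u t
    cancel : ∀ {u s t} → IsS u → c u s ≼ c u t → s ⊆ t
    down   : ∀ {u t x} → IsS u → x ≼ c u t → ∃[ s ] c u s ≈ x
    cover  : ∀ x → ∃₂ λ u s → IsS u × c u s ≈ x

  injective : ∀ {u s t} → IsS u → c u s ≈ c u t → s ≡ t
  injective u eq = ⊆-antisym (cancel u (reflexive eq)) (cancel u (reflexive (Eq.sym eq)))

  down-⊆ : ∀ {u t x} → IsS u → x ≼ c u t → ∃[ s ] s ⊆ t × c u s ≈ x
  down-⊆ u le = let s , eq = down u le in s , cancel u (≼-trans (reflexive eq) le) , eq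

  carry : ∀ {u v s t} → IsS u → IsS v → c u s ≈ c v t → ∀ {s′} → s′ ⊆ s → ∃[ t′ ] t′ ⊆ t × c u s′ ≈ c v t′
  carry u v eq s′⊆s =
    let t′ , sub , eq′ = down-⊆ v (≼-trans (mono u s′⊆s) (reflexive eq)) in t′ , sub , Eq.sym eq′

  -- The two faces chart the same interval of `P`, so changing charts embeds the lattice of faces of
  -- `s` into that of `t`.
  size-≤ : ∀ {u v s t} → IsS u → IsS v → c u s ≈ c v t → ∣ s ∣ ℕ.≤ ∣ t ∣
  size-≤ {u} {v} {s} {t} isu isv eq = embedding⇒≤ {θ = θ} record { mono = θ-mono ; cancel = θ-cancel }
    where
    image : ∀ w → ∃[ w′ ] c u (spread s w) ≈ c v (spread t w′)
    image w with carry isu isv eq (λ {x} → spread-⊆ s w {x})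
    ... | t′ , sub , eq′ with spread-surjective (λ {x} → sub {x})
    ...   | w′ , refl = w′ , eq′
    θ : Subset ∣ s ∣ → Subset ∣ t ∣
    θ = proj₁ ∘ image
    θ-spec : ∀ w → c u (spread s w) ≈ c v (spread t (θ w))
    θ-spec = proj₂ ∘ image
    module S = Embedding (spread-embedding s)
    module T = Embedding (spread-embedding t)
    θ-mono : ∀ {w w′} → w ⊆ w′ → θ w ⊆ θ w′
    θ-mono {w} {w′} sub = T.cancel (cancel isv (≤-respˡ-≈ (θ-spec w) (≤-respʳ-≈ (θ-spec w′) (mono isu (S.mono sub)))))
    θ-cancel : ∀ {w w′} → θ w ⊆ θ w′ → w ⊆ w′
    θ-cancel {w} {w′} sub = S.cancel (cancel isu
      (≤-respˡ-≈ (Eq.sym (θ-spec w)) (≤-respʳ-≈ (Eq.sym (θ-spec w′)) (mono isv (T.mono sub)))))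

  size-invariant : ∀ {u v s t} → IsS u → IsS v → c u s ≈ c v t → ∣ s ∣ ≡ ∣ t ∣
  size-invariant u v eq = ℕ.≤-antisym (size-≤ u v eq) (size-≤ v u (Eq.sym eq))

-- The condition for `c u s ↦ g u s` to be well defined on cells; the map itself is never
-- constructed.
Respects : ∀ {d} (IsS : Simplex d → Set) (P Q : Poset 0ℓ 0ℓ 0ℓ) →
           (Simplex d → Subset (suc d) → Poset.Carrier P) →
           (Simplex d → Subset (suc d) → Poset.Carrier Q) → Set
Respects IsS P Q c g = ∀ {u v s t} → IsS u → IsS v →
  Poset._≈_ P (c u s) (c v t) → Poset._≈_ Q (g u s) (g v t)

-- `Open` marks the facets still on the boundary. The index type is left free because an attachment
-- counts the facets of a disjoint union.
AtMostTwo : (P : Poset 0ℓ 0ℓ 0ℓ) → Pred (Poset.Carrier P) 0ℓ → {J : Set} → Pred J 0ℓ →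
            (J → Poset.Carrier P) → Set
AtMostTwo P Ridge Open facet = ∀ {x} → Ridge x → ∀ {p q r} → Open p → Open q → Open r →
  x ≼ facet p → x ≼ facet q → x ≼ facet r → p ≡ q ⊎ q ≡ r ⊎ p ≡ r
  where open Poset P using () renaming (_≤_ to _≼_)

module Isomorphism {P Q : Poset 0ℓ 0ℓ 0ℓ} (iso : P ≅ Q) where
  open _≅_ iso public
  open IsOrderIsomorphism isOrderIsomorphism public
    using (cong; mono; cancel; injective)

  private
    module P = Poset P
    module Q = Poset Q

  preimage-of : ∀ y → ∃[ x ] to x Q.≈ y
  preimage-of y = let x , eq = IsOrderIsomorphism.surjective isOrderIsomorphism y in x , eq P.Eq.refl

module Gluing {P Q : Poset 0ℓ 0ℓ 0ℓ} {σ τ : Poset.Carrier P} {φ : ↓ P σ ≅ ↓ P τ}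
              (identification : Identification P φ Q) where
  open Identification identification public

  private
    module P = Poset P
    module Q = Poset Q
    module φ = Isomorphism φ

  Φ : Rel P.Carrier 0ℓ
  Φ x y = Σ[ x≤σ ∈ x P.≤ σ ] proj₁ (φ.to (x , x≤σ)) P.≈ y

  Φ-total : ∀ {x} → x P.≤ σ → ∃[ y ] Φ x y
  Φ-total x≤σ = _ , x≤σ , P.Eq.refl

  Φ-onto : ∀ {y} → y P.≤ τ → ∃[ x ] Φ x y
  Φ-onto y≤τ = let (x , x≤σ) , eq = φ.preimage-of (_ , y≤τ) in x , x≤σ , eq

  Φ-≤τ : ∀ {x y} → Φ x y → y P.≤ τ
  Φ-≤τ (x≤σ , eq) = P.≤-respˡ-≈ eq (proj₂ (φ.to (_ , x≤σ)))

  Φ-mono : ∀ {x y x′ y′} → Φ x y → Φ x′ y′ → x P.≤ x′ → y P.≤ y′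
  Φ-mono (p , eq) (p′ , eq′) le = P.≤-respˡ-≈ eq (P.≤-respʳ-≈ eq′ (φ.mono le))

  Φ-cancel : ∀ {x y x′ y′} → Φ x y → Φ x′ y′ → y P.≤ y′ → x P.≤ x′
  Φ-cancel (p , eq) (p′ , eq′) le =
    φ.cancel (P.≤-respˡ-≈ (P.Eq.sym eq) (P.≤-respʳ-≈ (P.Eq.sym eq′) le))

  Φ-functional : ∀ {x y x′ y′} → Φ x y → Φ x′ y′ → x P.≈ x′ → y P.≈ y′
  Φ-functional (p , eq) (p′ , eq′) x≈x′ = P.Eq.trans (P.Eq.sym eq) (P.Eq.trans (φ.cong x≈x′) eq′)

  Φ-injective : ∀ {x y x′ y′} → Φ x y → Φ x′ y′ → y P.≈ y′ → x P.≈ x′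
  Φ-injective (p , eq) (p′ , eq′) y≈y′ =
    φ.injective (P.Eq.trans eq (P.Eq.trans y≈y′ (P.Eq.sym eq′)))

  Φ-resp : ∀ {x y x′ y′} → x P.≈ x′ → y P.≈ y′ → Φ x y → Φ x′ y′
  Φ-resp x≈x′ y≈y′ (p , eq) = P.≤-respˡ-≈ x≈x′ p ,
    P.Eq.trans (φ.cong (P.Eq.sym x≈x′)) (P.Eq.trans eq y≈y′)

  Φ-στ : Φ σ τ
  Φ-στ = let y , f  = Φ-total P.refl
             x , f′ = Φ-onto P.refl
         in Φ-resp P.Eq.refl (P.antisym (Φ-≤τ f) (Φ-mono f′ f (proj₁ f′))) f

  glued : ∀ {x y} → Φ x y → quot x Q.≈ quot y
  glued f = Equivalence.from (kernel _ _) (EqC.return (inj₂ f))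

  quot-cong : ∀ {x y} → x P.≈ y → quot x Q.≈ quot y
  quot-cong eq = Equivalence.from (kernel _ _) (EqC.return (inj₁ eq))

  quot-mono : ∀ {x y} → x P.≤ y → quot x Q.≤ quot y
  quot-mono le = Equivalence.from (order _ _) (_ , _ , Q.Eq.refl , Q.Eq.refl , le)

  data Merged (x y : P.Carrier) : Set where
    same     : x P.≈ y → Merged x y
    forward  : Φ x y → Merged x y
    backward : Φ y x → Merged x y

  private
    merged-trans : ∀ {x y z} → Merged x y → Merged y z → Merged x z
    merged-trans (same p)     (same q)     = same (P.Eq.trans p q)
    merged-trans (same p)     (forward q)  = forward (Φ-resp (P.Eq.sym p) P.Eq.refl q)
    merged-trans (same p)     (backward q) = backward (Φ-resp P.Eq.refl (P.Eq.sym p) q)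
    merged-trans (forward p)  (same q)     = forward (Φ-resp P.Eq.refl q p)
    merged-trans (backward p) (same q)     = backward (Φ-resp q P.Eq.refl p)
    -- Here `x` and `y` are both below `σ` and are identified, so `regular` makes them equal.
    merged-trans (forward p)  (forward q)  =
      let x≈y = regular (proj₁ p) (proj₁ q) (glued p)
      in same (P.Eq.trans x≈y (Φ-functional p q x≈y))
    merged-trans (forward p)  (backward q) = same (Φ-injective p q P.Eq.refl)
    merged-trans (backward p) (forward q)  = same (Φ-functional p q P.Eq.refl)
    merged-trans (backward p) (backward q) =
      let z≈y = regular (proj₁ q) (proj₁ p) (glued q)
      in same (P.Eq.trans (Φ-functional p q (P.Eq.sym z≈y)) (P.Eq.sym z≈y))

  -- Longer chains of identifications collapse, because no cell is glued to
  -- itself.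
  merged : ∀ {x y} → quot x Q.≈ quot y → Merged x y
  merged eq = chain (Equivalence.to (kernel _ _) eq)
    where
    step : ∀ {x y} → x P.≈ y ⊎ Φ x y → Merged x y
    step (inj₁ p) = same p
    step (inj₂ f) = forward f
    reverse : ∀ {x y} → Merged x y → Merged y x
    reverse (same p)     = same (P.Eq.sym p)
    reverse (forward f)  = backward f
    reverse (backward f) = forward f
    chain : ∀ {x y} → EqClosure (λ x y → x P.≈ y ⊎ Φ x y) x y → Merged x y
    chain ε            = same P.Eq.refl
    chain (fwd r ◅ rs) = merged-trans (step r) (chain rs)
    chain (bwd r ◅ rs) = merged-trans (reverse (step r)) (chain rs)

  -- `order` provides some representative of the upper cell. If it is not `y` but the partner of
  -- `y`, then `φ` or its inverse carries the lower cell over to `y`.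
  lift-≤ : ∀ {b y} → b Q.≤ quot y → ∃[ x ] x P.≤ y × quot x Q.≈ b
  lift-≤ {b} {y} le with Equivalence.to (order _ _) le
  ... | x , y′ , ex , ey , x≤y′ with merged ey
  ...   | same p     = x , P.≤-respʳ-≈ p x≤y′ , ex
  ...   | forward f  =
    let z , g = Φ-total (P.trans x≤y′ (proj₁ f))
    in z , Φ-mono g f x≤y′ , Q.Eq.trans (Q.Eq.sym (glued g)) ex
  ...   | backward f =
    let z , g = Φ-onto (P.trans x≤y′ (Φ-≤τ f))
    in z , Φ-cancel g f x≤y′ , Q.Eq.trans (glued g) ex

  lift-≤-regular : ∀ {x y z} → x P.≤ z → y P.≤ z → quot x Q.≤ quot y → x P.≤ y
  lift-≤-regular x≤z y≤z le =
    let x′ , x′≤y , eq = lift-≤ le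
    in P.≤-respˡ-≈ (regular (P.trans x′≤y y≤z) x≤z eq) x′≤y

  module _ {d} {IsS : Simplex d → Set} where

    -- A chart stays injective because `regular` forbids two faces of one simplex to be identified.
    quotientChart : ∀ {c} → Chart IsS P c → Chart IsS Q (λ u → quot ∘ c u)
    quotientChart {c} chart = record
      { mono   = λ isu sub → quot-mono (C.mono isu sub)
      ; cancel = λ isu le → C.cancel isu
          (lift-≤-regular (C.mono isu (⊆-max _)) (C.mono isu (⊆-max _)) le)
      ; down   = λ isu le → let x′ , x′≤ , eq  = lift-≤ le
                                s , eq′ = C.down isu x′≤
                            in s , Q.Eq.trans (quot-cong eq′) eq
      ; cover  = λ b → let x , eq = surjective b
                           u , s , isu , eq′ = C.cover x
                       in u , s , isu , Q.Eq.trans (quot-cong eq′) eq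
      }
      where module C = Chart chart

    -- By `merged`, the only new coincidences are the pairs in `Φ`, so compatibility needs checking
    -- only there.
    quotientRespects : ∀ {R : Poset 0ℓ 0ℓ 0ℓ} {c g} → Respects IsS P R c g →
      (∀ {u v s t} → IsS u → IsS v → Φ (c u s) (c v t) → Poset._≈_ R (g u s) (g v t)) →
      Respects IsS Q R (λ u → quot ∘ c u) g
    quotientRespects {R} resp compat isu isv eq with merged eq
    ... | same p     = resp isu isv p
    ... | forward f  = compat isu isv f
    ... | backward f = Poset.Eq.sym R (compat isv isu f)

  module _ {Ridge : Pred P.Carrier 0ℓ} {Ridge′ : Pred Q.Carrier 0ℓ}
           (ridge⁻ : ∀ {x y} → Ridge′ y → quot x Q.≈ y → Ridge x)
           {J : Set} {Open : Pred J 0ℓ} {facet : J → P.Carrier}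
           (two : AtMostTwo P Ridge Open facet)
           {a b : J} (open-a : Open a) (open-b : Open b) (a-σ : facet a P.≈ σ) (b-τ : facet b P.≈ τ)
           where

    private
      Remains : Pred J 0ℓ
      Remains p = Open p × p ≢ a × p ≢ b

      over-a : ∀ {x} → x P.≤ σ → x P.≤ facet a
      over-a = P.≤-respʳ-≈ (P.Eq.sym a-σ)
      over-b : ∀ {x} → x P.≤ τ → x P.≤ facet b
      over-b = P.≤-respʳ-≈ (P.Eq.sym b-τ)

      -- A facet `e` that is about to disappear already takes one of the two places over the ridge.
      third : ∀ {x} → Ridge x → ∀ {e p q} → Open e → x P.≤ facet e → Open p → p ≢ e → Open q → q ≢ e →
              x P.≤ facet p → x P.≤ facet q → p ≡ q
      third rx oe xe op p≢e oq q≢e xp xq with two rx oe op oq xe xp xq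
      ... | inj₁ e≡p        = contradiction (sym e≡p) p≢e
      ... | inj₂ (inj₁ p≡q) = p≡q
      ... | inj₂ (inj₂ e≡q) = contradiction (sym e≡q) q≢e

      -- Over x there are a and p, over y there are b and q.
      crossed : ∀ {x y z} → Ridge x → Ridge y → ∀ {p q r} → Remains p → Remains q → Remains r →
                x P.≤ facet p → y P.≤ facet q → z P.≤ facet r → Φ x y → Merged x z → p ≡ r ⊎ q ≡ r
      crossed rx ry (op , pa , pb) (oq , qa , qb) (or , ra , rb) xp yq zr f (same x≈z) =
        inj₁ (third rx open-a (over-a (proj₁ f)) op pa or ra xp (P.≤-respˡ-≈ (P.Eq.sym x≈z) zr))
      crossed rx ry (op , pa , pb) (oq , qa , qb) (or , ra , rb) xp yq zr f (forward g) =
        inj₂ (third ry open-b (over-b (Φ-≤τ f)) oq qb or rb yq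
          (P.≤-respˡ-≈ (P.Eq.sym (Φ-functional f g P.Eq.refl)) zr))
      crossed rx ry (op , pa , pb) (oq , qa , qb) (or , ra , rb) xp yq zr f (backward g) =
        inj₁ (third rx open-a (over-a (proj₁ f)) op pa or ra xp
          (P.≤-respˡ-≈ (regular (proj₁ g) (proj₁ f) (glued g)) zr))

    -- The new ridge comes from one old ridge or from two matched ones. If two are merged, `a` lies
    -- over one and `b` over the other, each leaving room for a single further facet. If a single
    -- ridge lies below `σ` or `τ`, the same count leaves even less room.
    quotientAtMostTwo : AtMostTwo Q Ridge′ Remains (quot ∘ facet)
    quotientAtMostTwo ridge {p} {q} {r} p′@(op , pa , pb) q′@(oq , qa , qb) r′@(or , ra , rb) xp xq xr
      with lift-≤ xp | lift-≤ xq | lift-≤ xr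
    ... | x , x≤p , ex | y , y≤q , ey | z , z≤r , ez
      with merged (Q.Eq.trans ex (Q.Eq.sym ey)) | merged (Q.Eq.trans ex (Q.Eq.sym ez))
    ... | same x≈y | same x≈z = two (ridge⁻ ridge ex) op oq or x≤p
                                  (P.≤-respˡ-≈ (P.Eq.sym x≈y) y≤q) (P.≤-respˡ-≈ (P.Eq.sym x≈z) z≤r)
    ... | same x≈y | forward g =
      inj₁ (third (ridge⁻ ridge ex) open-a (over-a (proj₁ g)) op pa oq qa x≤p (P.≤-respˡ-≈ (P.Eq.sym x≈y) y≤q))
    ... | same x≈y | backward g =
      inj₁ (third (ridge⁻ ridge ex) open-b (over-b (Φ-≤τ g)) op pb oq qb x≤p (P.≤-respˡ-≈ (P.Eq.sym x≈y) y≤q))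
    ... | forward f  | m with crossed (ridge⁻ ridge ex) (ridge⁻ ridge ey) p′ q′ r′ x≤p y≤q z≤r f m
    ...   | inj₁ p≡r = inj₂ (inj₂ p≡r)
    ...   | inj₂ q≡r = inj₂ (inj₁ q≡r)
    quotientAtMostTwo ridge {p} {q} {r} p′@(op , pa , pb) q′@(oq , qa , qb) r′@(or , ra , rb) xp xq xr
      | x , x≤p , ex | y , y≤q , ey | z , z≤r , ez
      | backward f | m with crossed (ridge⁻ ridge ey) (ridge⁻ ridge ex) q′ p′ r′ y≤q x≤p z≤r f
                              (merged (Q.Eq.trans ey (Q.Eq.sym ez)))
    ...   | inj₁ q≡r = inj₂ (inj₁ q≡r)
    ...   | inj₂ p≡r = inj₂ (inj₂ p≡r)

-- The invariants of a local construction

-- An order embedding given by its graph, which suits maps known only through coincidences of cells.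
record Correspondence {m n} (R : Subset m → Subset n → Set) : Set where
  field
    total  : ∀ s → ∃[ t ] R s t
    mono   : ∀ {s s′ t t′} → R s t → R s′ t′ → s ⊆ s′ → t ⊆ t′
    cancel : ∀ {s s′ t t′} → R s t → R s′ t′ → t ⊆ t′ → s ⊆ s′

  functional : ∀ {s t t′} → R s t → R s t′ → t ≡ t′
  functional r r′ = ⊆-antisym (mono r r′ ⊆-refl) (mono r′ r ⊆-refl)

  embedding : Embedding (proj₁ ∘ total)
  embedding = record
    { mono   = mono (proj₂ (total _)) (proj₂ (total _))
    ; cancel = cancel (proj₂ (total _)) (proj₂ (total _))
    }

correspondence-determined : ∀ {m n} {R R′ : Subset (suc n) → Subset m → Set} r →
  Correspondence R → Correspondence R′ → (∀ t → ∃[ s ] R s t) →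
  (∀ {v s t} → R (fac r v) s → R′ (fac r v) t → s ≡ t) →
  ∀ {w s t} → R w s → R′ w t → s ≡ t
correspondence-determined {R = R} {R′} r corr corr′ onto agree {w} Rws R′wt =
  trans (C.functional Rws (proj₂ (C.total w)))
    (trans (embedding-determined r C.embedding C′.embedding image
             (λ v → agree (proj₂ (C.total _)) (proj₂ (C′.total _))) w)
      (C′.functional (proj₂ (C′.total w)) R′wt))
  where
  module C  = Correspondence corr
  module C′ = Correspondence corr′
  image : ∀ t → ∃[ s ] proj₁ (C′.total t) ≡ proj₁ (C.total s)
  image t = let s , Rst = onto (proj₁ (C′.total t)) in s , C.functional Rst (proj₂ (C.total s))

-- Through the interval below the cell the two boolean lattices embed into each other. This ties the
-- `rank` of a cell to the size of the faces that chart it.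
iso-size : ∀ {d IsS P c} → Chart {d} IsS P c → ∀ {u s n} → IsS u →
           ↓ P (c u s) ≅ ⊆-poset n → n ≡ ∣ s ∣
iso-size {P = P} {c} chart {u} {s} {n} isu iso = ℕ.≤-antisym
  (embedding⇒≤ (record { mono = λ {w} {w′} → θ-mono {w} {w′} ; cancel = λ {w} {w′} → θ-cancel {w} {w′} }))
  (embedding⇒≤ (record { mono = λ {w} {w′} → η-mono {w} {w′} ; cancel = λ {w} {w′} → η-cancel {w} {w′} }))
  where
  open Poset P using (_≈_) renaming (_≤_ to _≼_)
  module C = Chart chart
  module I = Isomorphism iso
  module S = Embedding (spread-embedding s)
  η : Subset ∣ s ∣ → Subset n
  η w = I.to (c u (spread s w) , C.mono isu (spread-⊆ s w))
  η-mono : ∀ {w w′} → w ⊆ w′ → η w ⊆ η w′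
  η-mono sub = I.mono (C.mono isu (S.mono sub))
  η-cancel : ∀ {w w′} → η w ⊆ η w′ → w ⊆ w′
  η-cancel {w} {w′} sub = S.cancel (C.cancel isu
    (I.cancel {_ , C.mono isu (spread-⊆ s w)} {_ , C.mono isu (spread-⊆ s w′)} sub))
  back : ∀ v → ∃[ w ] Σ[ p ∈ c u (spread s w) ≼ c u s ] I.to (c u (spread s w) , p) ≡ v
  back v with I.preimage-of v
  ... | (x , x≤) , eq with C.down-⊆ isu x≤
  ...   | s′ , sub , eq′ with spread-surjective (λ {x} → sub {x})
  ...     | w , refl = w , C.mono isu (spread-⊆ s w) , trans (I.cong eq′) eq
  θ : Subset n → Subset ∣ s ∣
  θ = proj₁ ∘ back
  θ-mono : ∀ {v v′} → v ⊆ v′ → θ v ⊆ θ v′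
  θ-mono {v} {v′} sub = S.cancel (C.cancel isu (I.cancel {_ , proj₁ (proj₂ (back v))} {_ , proj₁ (proj₂ (back v′))}
    (subst₂ _⊆_ (sym (proj₂ (proj₂ (back v)))) (sym (proj₂ (proj₂ (back v′)))) sub)))
  θ-cancel : ∀ {v v′} → θ v ⊆ θ v′ → v ⊆ v′
  θ-cancel {v} {v′} sub = subst₂ _⊆_ (proj₂ (proj₂ (back v))) (proj₂ (proj₂ (back v′)))
    (I.mono {_ , proj₁ (proj₂ (back v))} {_ , proj₁ (proj₂ (back v′))} (C.mono isu (S.mono sub)))

-- A label just r on a boundary facet of the tree says that the facet gets folded along
-- its r-th ridge.
Labelling : ℕ → Set
Labelling d = Facet d → Maybe (Fin d)

module _ {e : ℕ} where

  private
    d : ℕ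
    d = suc e

  module _ {P : Poset 0ℓ 0ℓ 0ℓ} (c : Simplex d → Subset (suc d) → Poset.Carrier P) where
    open Poset P using (Carrier; _≈_) renaming (_≤_ to _≼_)

    facetCell : Facet d → Carrier
    facetCell a = c (parent a) (fac (color a) ⊤)

    ridgeCell : Facet d → Fin d → Carrier
    ridgeCell a r = c (parent a) (fac (color a) (fac r ⊤))

    -- Demanded of every face that charts the cell, so that the property passes from a class in a
    -- quotient back to its representatives.
    IsRidge : (Simplex d → Set) → Pred Carrier 0ℓ
    IsRidge IsS x = ∀ {u s} → IsS u → c u s ≈ x → suc ∣ s ∣ ≡ d

  Unglued : Forest d → Labelling d → Pred (Facet d) 0ℓ
  Unglued F lab a = IsBoundary F a × lab a ≡ nothing

  Glued : (F : Forest d) (P : Poset 0ℓ 0ℓ 0ℓ) → (Simplex d → Subset (suc d) → Poset.Carrier P) → Set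
  Glued F P c = ∀ {a} → IsSimplex F (beyond a) → ∀ t →
    Poset._≈_ P (c (beyond a) (fac (color a) t)) (c (parent a) (fac (color a) t))

  -- All that is asked of a complex receiving a comparison: charts, the gluings of the tree, and in
  -- `matched` the rule that facets whose labels name one ridge coincide. No trace of the order of
  -- the folds remains.
  record Folded (F : Forest d) (P : Poset 0ℓ 0ℓ 0ℓ) (lab : Labelling d)
                (c : Simplex d → Subset (suc d) → Poset.Carrier P) : Set where
    open Poset P using (Carrier; _≈_) renaming (_≤_ to _≼_)
    field
      chart   : Chart (IsSimplex F) P c
      glue    : Glued F P c
      matched : ∀ {a b r s} → IsBoundary F a → IsBoundary F b → lab a ≡ just r → lab b ≡ just s →
                ridgeCell {P} c a r ≈ ridgeCell {P} c b s →
                a ≡ b ⊎ facetCell {P} c a ≈ facetCell {P} c b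

  -- `tops` and `elsewhere` serve to recognise boundary cells as unlabelled facets. At a fold,
  -- `atMostTwo` gives `sealed` for the new labels, and `sealed` protects `matched` for the old
  -- ones.
  record System (F : Forest d) (P : Poset 0ℓ 0ℓ 0ℓ) (lab : Labelling d)
                (c : Simplex d → Subset (suc d) → Poset.Carrier P) : Set where
    open Poset P using (Carrier; _≈_) renaming (_≤_ to _≼_)
    field
      folded    : Folded F P lab c
      rooted    : IsSimplex F root
      tops      : ∀ {u v} → IsSimplex F u → IsSimplex F v → c u ⊤ ≈ c v ⊤ → u ≡ v
      elsewhere : ∀ {a r} → IsBoundary F a → lab a ≡ just r →
                  ∃₂ λ v t → IsSimplex F v × v ≢ parent a × c v t ≈ facetCell {P} c a
      atMostTwo : AtMostTwo P (IsRidge {P} c (IsSimplex F)) (Unglued F lab) (facetCell {P} c)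
      sealed    : ∀ {a r b} → IsBoundary F a → lab a ≡ just r → Unglued F lab b →
                  ¬ (ridgeCell {P} c a r ≼ facetCell {P} c b)

    open Folded folded public
    open Chart chart public

    parent-simplex′ : ∀ {a} → IsBoundary F a → IsSimplex F (parent a)
    parent-simplex′ = parent-of-boundary rooted

    top-not-below : ∀ {u a} → IsSimplex F u → IsBoundary F a → ¬ (c u ⊤ ≼ facetCell {P} c a)
    top-not-below {u} {a} isu bd le =
      let s , sub , eq = down-⊆ (parent-simplex′ bd) le
          ∣s∣≡ = trans (size-invariant (parent-simplex′ bd) isu eq) (∣⊤∣≡n (suc d))
          ∣s∣≤ = ℕ.≤-trans (p⊆q⇒∣p∣≤∣q∣ sub) (ℕ.≤-reflexive (trans (∣fac∣ (color a) ⊤) (∣⊤∣≡n d)))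
      in ℕ.1+n≰n (ℕ.≤-trans (ℕ.≤-reflexive (sym ∣s∣≡)) ∣s∣≤)

  -- P has no identifications besides those that the tree and the labels force.
  Universal : (F : Forest d) (P : Poset 0ℓ 0ℓ 0ℓ) → Labelling d →
              (Simplex d → Subset (suc d) → Poset.Carrier P) → Set₁
  Universal F P lab c = ∀ {R lab′ g} → Folded F R lab′ g →
    (∀ {a r} → IsBoundary F a → lab a ≡ just r → lab′ a ≡ just r) →
    Respects (IsSimplex F) P R c g

  module OnManifold (T : Pseudomanifold d) where
    open Pseudomanifold T using (rank; ∂; IsFacetOver) renaming (facePoset to P) public
    private module T = Pseudomanifold T

    module _ {F : Forest d} {lab c} (system : System F P lab c) where
      open System system

      rank-size : ∀ {u s} → IsSimplex F u → rank (c u s) ≡ ∣ s ∣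
      rank-size isu = iso-size chart isu (T.boolean (c _ _))

      -- In every other case there is a second simplex with this facet: the parent if it is the
      -- entrance of `u`, the simplex beyond it if it is interior, the one given by `elsewhere` if
      -- it is labelled.
      unglued-facet : ∀ {u f} → IsSimplex F u →
        (∀ {v t} → IsSimplex F v → c v t ≡ c u (fac f ⊤) → v ≡ u) →
        ∃[ a ] Unglued F lab a × facetCell {P} c a ≡ c u (fac f ⊤)
      unglued-facet {u} {f} isu only with facet-cases u f
      ... | inj₁ (a , refl , refl) = contradiction
        (only (parent-of-interior rooted isu) (sym (glue isu ⊤))) (parent≢beyond a)
      ... | inj₂ (a , refl , refl) with boundary-or-interior isu
      ...   | inj₂ int = contradiction (sym (only int (glue int ⊤))) (parent≢beyond a)
      ...   | inj₁ bd with lab a in eq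
      ...     | nothing = a , (bd , eq) , refl
      ...     | just r  = let v , t , isv , v≢ , eq′ = elsewhere bd eq
                          in contradiction (only isv eq′) v≢

      facet-over-once : ∀ {u s} → IsSimplex F u → rank (c u s) ≡ d → ∃! _≡_ (IsFacetOver (c u s)) →
                        ∃[ a ] Unglued F lab a × facetCell {P} c a ≡ c u s
      facet-over-once {u} {s} isu dim (x , _ , unique) with corank-one s (trans (sym (rank-size isu)) dim)
      ... | f , refl = unglued-facet isu λ isv eq →
        tops isv isu (trans (sym (unique (over isv eq))) (unique (over isu refl)))
        where
        over : ∀ {v t} → IsSimplex F v → c v t ≡ c u (fac f ⊤) → IsFacetOver (c u (fac f ⊤)) (c v ⊤)
        over {v} {t} isv eq = trans (rank-size isv) (∣⊤∣≡n (suc d)) ,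
                      Poset.≤-respˡ-≈ P eq (mono isv (⊆-max t))

      -- By definition of `∂` the cell lies below some facet `σ′` with a single coface; since the
      -- ranks are equal, it is `σ′`.
      boundary-facet : ∀ {σ} → rank σ ≡ d → ∂ σ → ∃[ a ] Unglued F lab a × facetCell {P} c a ≡ σ
      boundary-facet {σ} σ-dim (σ′ , σ′-dim , once , σ⊑σ′) =
        let u , s , isu , eq = cover σ′
            s′ , sub , eq′   = down-⊆ isu (subst (σ T.⊑_) (sym eq) σ⊑σ′)
            ∣s∣≡d            = trans (sym (rank-size isu)) (trans (cong rank eq) σ′-dim)
            ∣s′∣≡d           = trans (sym (rank-size isu)) (trans (cong rank eq′) σ-dim)
            s′≡s             = ⊆∧∣≡∣⇒≡ sub (trans ∣s′∣≡d (sym ∣s∣≡d))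
            σ′≡σ             = trans (sym eq) (trans (cong (c u) (sym s′≡s)) eq′)
            a , ua , eq″     = facet-over-once isu (trans (cong rank eq) σ′-dim)
                                 (subst (∃! _≡_ ∘ IsFacetOver) (sym eq) once)
        in a , ua , trans eq″ (trans eq σ′≡σ)

-- Folding two boundary facets along a ridge

module _ {e : ℕ} where

  private
    d : ℕ
    d = suc e

  module _ {P : Poset 0ℓ 0ℓ 0ℓ} {IsS : Simplex d → Set} {c : Simplex d → Subset (suc d) → Poset.Carrier P}
           (chart : Chart IsS P c) where
    open Poset P using (_≈_) renaming (_≤_ to _≼_; module Eq to ≈)
    private module C = Chart chart

    faces-of-facet : ∀ {u f x} → IsS u → x ≼ c u (fac f ⊤) → ∃[ w ] c u (fac f w) ≈ x
    faces-of-facet {f = f} isu le with C.down-⊆ isu le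
    ... | s , sub , eq with ⊆-fac f (λ {x} → sub {x})
    ...   | w , refl , _ = w , eq

    facets-correspond : ∀ {u v f g} → IsS u → IsS v → c u (fac f ⊤) ≈ c v (fac g ⊤) →
      Correspondence (λ w w′ → c u (fac f w) ≈ c v (fac g w′)) ×
      (∀ w′ → ∃[ w ] c u (fac f w) ≈ c v (fac g w′))
    facets-correspond {u} {v} {f} {g} isu isv eq = record
      { total  = λ w → let w′ , eq′ = faces-of-facet isv (Poset.≤-respʳ-≈ P eq (C.mono isu (fac-⊆ f (⊆-max w))))
                       in w′ , ≈.sym eq′
      ; mono   = λ r r′ sub → insertAt-⊆⁻ g (C.cancel isv
                   (Poset.≤-respˡ-≈ P r (Poset.≤-respʳ-≈ P r′ (C.mono isu (fac-⊆ f sub)))))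
      ; cancel = λ r r′ sub → insertAt-⊆⁻ f (C.cancel isu
                   (Poset.≤-respˡ-≈ P (≈.sym r) (Poset.≤-respʳ-≈ P (≈.sym r′) (C.mono isv (fac-⊆ g sub)))))
      } , λ w′ → faces-of-facet isu (Poset.≤-respʳ-≈ P (≈.sym eq) (C.mono isv (fac-⊆ g (⊆-max w′))))

  mark : Labelling d → Facet d → Fin d → Labelling d
  mark lab a r p with p ≟ᶠ a
  ... | yes _ = just r
  ... | no  _ = lab p

  mark-here : ∀ lab a r → mark lab a r a ≡ just r
  mark-here lab a r with a ≟ᶠ a
  ... | yes _ = refl
  ... | no a≢a = contradiction refl a≢a

  mark-other : ∀ lab a r {p} → p ≢ a → mark lab a r p ≡ lab p
  mark-other lab a r {p} p≢a with p ≟ᶠ a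
  ... | yes p≡a = contradiction p≡a p≢a
  ... | no  _   = refl

  mark-just : ∀ lab a r {p s} → mark lab a r p ≡ just s → (p ≡ a × s ≡ r) ⊎ lab p ≡ just s
  mark-just lab a r {p} eq with p ≟ᶠ a
  mark-just lab a r refl | yes p≡a = inj₁ (p≡a , refl)
  mark-just lab a r eq   | no  _   = inj₂ eq

  mark-nothing : ∀ lab a r {p} → mark lab a r p ≡ nothing → lab p ≡ nothing × p ≢ a
  mark-nothing lab a r {p} eq with p ≟ᶠ a
  mark-nothing lab a r () | yes _
  ... | no p≢a = eq , p≢a

  module _ (T T′ : Pseudomanifold d) where

    private
      P = Pseudomanifold.facePoset T
      Q = Pseudomanifold.facePoset T′

    module Fold {F : Forest d} {lab c} (system : System F P lab c) (universal : Universal F P lab c)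
                {σ τ : Pseudomanifold.Cell T} {φ : ↓ P σ ≅ ↓ P τ} (identify : Identification P φ Q) (σ≢τ : σ ≢ τ)
                {a b} (open-a : Unglued F lab a) (open-b : Unglued F lab b)
                (a-σ : facetCell {P = P} c a ≡ σ) (b-τ : facetCell {P = P} c b ≡ τ)
                {ρ r s} (ridge-a : ridgeCell {P = P} c a r ≡ ρ) (ridge-b : ridgeCell {P = P} c b s ≡ ρ)
                (ridge-ρ : IsRidge {P = P} c (IsSimplex F) ρ)
                (ρ≤σ : Poset._≤_ P ρ σ) (ρ≤τ : Poset._≤_ P ρ τ)
                (φ-fixes : ∀ x (x≤σ : Poset._≤_ P x σ) → Poset._≤_ P x ρ → proj₁ (_≅_.to φ (x , x≤σ)) ≡ x)
                where
      open Gluing identify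
      open System system
      private
        module P = Poset P

        c′ : Simplex d → Subset (suc d) → Poset.Carrier Q
        c′ u = quot ∘ c u

        facet : Facet d → P.Carrier
        facet = facetCell {P = P} c
        ridge : Facet d → Fin d → P.Carrier
        ridge = ridgeCell {P = P} c
        Ridge : Pred P.Carrier 0ℓ
        Ridge = IsRidge {P = P} c (IsSimplex F)

        is-a : IsSimplex F (parent a)
        is-a = parent-simplex′ (proj₁ open-a)
        is-b : IsSimplex F (parent b)
        is-b = parent-simplex′ (proj₁ open-b)

        a≢b : a ≢ b
        a≢b a≡b = σ≢τ (trans (sym a-σ) (trans (cong facet a≡b) b-τ))

        under-a : ∀ {x} → x P.≤ σ → x P.≤ facet a
        under-a = P.≤-respʳ-≈ (sym a-σ)
        under-σ : ∀ {x} → x P.≤ facet a → x P.≤ σ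
        under-σ = P.≤-respʳ-≈ a-σ
        under-b : ∀ {x} → x P.≤ τ → x P.≤ facet b
        under-b = P.≤-respʳ-≈ (sym b-τ)

        Φ-below-ρ : ∀ {x} → x P.≤ ρ → Φ x x
        Φ-below-ρ le = P.trans le ρ≤σ , φ-fixes _ (P.trans le ρ≤σ) le

        -- `φ` fixes `ρ`, so the partner of `ρ` in either direction is `ρ` itself.
        isolated : ∀ {x} → quot x ≡ quot ρ → x ≡ ρ
        isolated eq with merged eq
        ... | same x≡ρ   = x≡ρ
        ... | forward f  = Φ-injective f (Φ-below-ρ P.refl) refl
        ... | backward f = sym (Φ-functional (Φ-below-ρ P.refl) f refl)

      newLabels : Labelling d
      newLabels = mark (mark lab a r) b s

      private
        data Origin (p : Facet d) (k : Fin d) : Set where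
          new : Unglued F lab p → ridge p k ≡ ρ → ρ P.≤ facet p → quot (facet p) ≡ quot (facet a) →
                (∃[ q ] IsSimplex F (parent q) × parent q ≢ parent p × quot (facet q) ≡ quot (facet p)) → Origin p k
          old : lab p ≡ just k → Origin p k

        quot-a≡quot-b : quot (facet a) ≡ quot (facet b)
        quot-a≡quot-b = trans (cong quot a-σ) (trans (glued Φ-στ) (cong quot (sym b-τ)))

        -- Inside one simplex `regular` would turn the identification of the two facets into an
        -- equality. Each of them therefore gets the other one's simplex as witness for `elsewhere`.
        parents-differ : parent a ≢ parent b
        parents-differ eq = σ≢τ (trans (sym a-σ) (trans (regular
          (mono is-a (⊆-max _)) (subst (λ u → facet b P.≤ c u ⊤) (sym eq) (mono is-b (⊆-max _))) quot-a≡quot-b) b-τ))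

        origin : ∀ {p k} → newLabels p ≡ just k → Origin p k
        origin {p} eq with mark-just (mark lab a r) b s {p} eq
        ... | inj₁ (refl , refl) = new open-b ridge-b (under-b ρ≤τ) (sym quot-a≡quot-b)
                (a , is-a , parents-differ , quot-a≡quot-b)
        ... | inj₂ eq′ with mark-just lab a r {p} eq′
        ...   | inj₁ (refl , refl) = new open-a ridge-a (under-a ρ≤σ) refl
                (b , is-b , parents-differ ∘ sym , sym quot-a≡quot-b)
        ...   | inj₂ eq″ = old eq″

        remains : ∀ {p} → Unglued F newLabels p → Unglued F lab p × p ≢ a × p ≢ b
        remains {p} (bd , eq) =
          let eq′ , p≢b = mark-nothing (mark lab a r) b s {p} eq
              eq″ , p≢a = mark-nothing lab a r {p} eq′
          in (bd , eq″) , p≢a , p≢b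

        extends : ∀ {p k} → lab p ≡ just k → newLabels p ≡ just k
        extends {p} eq = trans (mark-other (mark lab a r) b s (p≢ open-b))
                               (trans (mark-other lab a r (p≢ open-a)) eq)
          where
          p≢ : ∀ {q} → Unglued F lab q → p ≢ q
          p≢ (_ , none) refl with () ← trans (sym none) eq

        -- The class of a labelled ridge is untouched by the gluing: neither σ nor τ lies over it.
        stays : ∀ {p k x} → IsBoundary F p → lab p ≡ just k → quot x ≡ quot (ridge p k) → x ≡ ridge p k
        stays bd eq q with merged q
        ... | same x≡ = x≡
        ... | forward f  = contradiction (under-b (Φ-≤τ f)) (sealed bd eq open-b)
        ... | backward f = contradiction (under-a (proj₁ f)) (sealed bd eq open-a)

        matched′ : ∀ {p q k l} → IsBoundary F p → IsBoundary F q → newLabels p ≡ just k → newLabels q ≡ just l →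
                   quot (ridge p k) ≡ quot (ridge q l) → p ≡ q ⊎ quot (facet p) ≡ quot (facet q)
        matched′ bp bq ep eq ridges with origin ep | origin eq
        ... | new _ _ _ fp _    | new _ _ _ fq _    = inj₂ (trans fp (sym fq))
        ... | old lp            | old lq            =
          Sum.map₂ (cong quot) (matched bp bq lp lq (stays bq lq ridges))
        -- The ridge already labelled at `q` would be `ρ`, which lies below the hitherto unlabelled
        -- facet `p`; `sealed` excludes this.
        ... | new op rp ρ≤p _ _ | old lq            =
          contradiction (P.≤-respˡ-≈ (trans (sym rp) (stays bq lq ridges)) ρ≤p) (sealed bq lq op)
        ... | old lp            | new oq rq ρ≤q _ _ =
          contradiction (P.≤-respˡ-≈ (trans (sym rq) (stays bp lp (sym ridges))) ρ≤q) (sealed bp lp oq)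

        folded′ : Folded F Q newLabels c′
        folded′ = record
          { chart   = quotientChart chart
          ; glue    = λ is t → cong quot (glue is t)
          ; matched = matched′
          }

        tops′ : ∀ {u v} → IsSimplex F u → IsSimplex F v → quot (c u ⊤) ≡ quot (c v ⊤) → u ≡ v
        tops′ isu isv eq with merged eq
        ... | same eq′   = tops isu isv eq′
        ... | forward f  = contradiction (under-a (proj₁ f)) (top-not-below isu (proj₁ open-a))
        ... | backward f = contradiction (under-a (proj₁ f)) (top-not-below isv (proj₁ open-a))

        elsewhere′ : ∀ {p k} → IsBoundary F p → newLabels p ≡ just k →
                     ∃₂ λ v t → IsSimplex F v × v ≢ parent p × c′ v t ≡ quot (facet p)
        elsewhere′ bd eq with origin eq
        ... | new _ _ _ _ (q , isq , q≢ , eq′) = parent q , _ , isq , q≢ , eq′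
        ... | old lp = let v , t , isv , v≢ , eq′ = elsewhere bd lp in v , t , isv , v≢ , cong quot eq′

        ridge⁻ : ∀ {x y} → IsRidge {P = Q} c′ (IsSimplex F) y → quot x ≡ y → Ridge x
        ridge⁻ ry eq isu eq′ = ry isu (trans (cong quot eq′) eq)

        atMostTwo′ : AtMostTwo Q (IsRidge {P = Q} c′ (IsSimplex F)) (Unglued F newLabels) (quot ∘ facet)
        atMostTwo′ ry op oq or = quotientAtMostTwo {Ridge = Ridge} {Ridge′ = IsRidge {P = Q} c′ (IsSimplex F)}
          ridge⁻ atMostTwo open-a open-b a-σ b-τ ry (remains op) (remains oq) (remains or)

        sealed′ : ∀ {p k q} → IsBoundary F p → newLabels p ≡ just k → Unglued F newLabels q →
                  ¬ (Poset._≤_ Q (quot (ridge p k)) (quot (facet q)))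
        sealed′ bp eq oq′ le with remains oq′ | lift-≤ le | origin eq
        ... | oq , q≢a , q≢b | x , x≤q , ex | old lp =
          sealed bp lp oq (P.≤-respˡ-≈ (stays bp lp ex) x≤q)
        -- `a` and `b` fill the two places over `ρ`, and by `isolated` no other cell has become part
        -- of its class.
        ... | oq , q≢a , q≢b | x , x≤q , ex | new _ rp _ _ _
          with atMostTwo ridge-ρ open-a open-b oq (under-a ρ≤σ) (under-b ρ≤τ)
               (P.≤-respˡ-≈ (isolated (trans ex (cong quot rp))) x≤q)
        ...   | inj₁ a≡b        = a≢b a≡b
        ...   | inj₂ (inj₁ b≡q) = q≢b (sym b≡q)
        ...   | inj₂ (inj₂ a≡q) = q≢a (sym a≡q)

        module _ {R : Poset 0ℓ 0ℓ 0ℓ} {lab″ g} (target : Folded F R lab″ g)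
                 (ext : ∀ {p k} → IsBoundary F p → newLabels p ≡ just k → lab″ p ≡ just k) where
          private module R = Poset R

          respects : Respects (IsSimplex F) P R c g
          respects = universal target λ bd eq → ext bd (extends eq)

          private
            module G = Folded target
            module GC = Chart G.chart
            f = color a
            h = color b


            -- The two ridges are one cell in `P`, hence by induction one cell in `R`. The labels
            -- are present in `R` too, so its own rule `matched` identifies the facets, whenever
            -- that fold took place there.
            facets-agree : facetCell {P = R} g a R.≈ facetCell {P = R} g b
            facets-agree with G.matched (proj₁ open-a) (proj₁ open-b)
              (ext (proj₁ open-a) (trans (mark-other (mark lab a r) b s a≢b) (mark-here lab a r)))
              (ext (proj₁ open-b) (mark-here (mark lab a r) b s))
              (respects is-a is-b (trans ridge-a (sym ridge-b)))
            ... | inj₁ a≡b = contradiction a≡b a≢b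
            ... | inj₂ eq  = eq

            Φ-faces : Correspondence (λ w w′ → Φ (c (parent a) (fac f w)) (c (parent b) (fac h w′)))
            Φ-faces = record
              { total  = λ w →
                  let y , φxy = Φ-total (under-σ (mono is-a (fac-⊆ f (⊆-max w))))
                      w′ , eq = faces-of-facet chart is-b (under-b (Φ-≤τ φxy))
                  in w′ , Φ-resp refl (sym eq) φxy
              ; mono   = λ r r′ sub → insertAt-⊆⁻ h (cancel is-b (Φ-mono r r′ (mono is-a (fac-⊆ f sub))))
              ; cancel = λ r r′ sub → insertAt-⊆⁻ f (cancel is-a (Φ-cancel r r′ (mono is-b (fac-⊆ h sub))))
              }

            -- On faces of the ridge `φ` is the identity, and `R` inherits the resulting
            -- coincidences from `P`.
            agree : ∀ {v w w′} → g (parent a) (fac f (fac r v)) R.≈ g (parent b) (fac h w) →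
                    Φ (c (parent a) (fac f (fac r v))) (c (parent b) (fac h w′)) → w ≡ w′
            agree {v} eq φxy = fac-injective h (GC.injective is-b (R.Eq.trans (R.Eq.sym eq) (respects is-a is-b
              (Φ-functional (Φ-below-ρ (P.≤-respʳ-≈ ridge-a (mono is-a (fac-⊆ f (fac-⊆ r (⊆-max v)))))) φxy refl))))

          -- `φ` and the coincidence of facets in `R` give two correspondences between the faces of
          -- `a` and of `b`. They agree on the ridge, hence everywhere by
          -- `correspondence-determined`.
          compatible : ∀ {u v t t′} → IsSimplex F u → IsSimplex F v → Φ (c u t) (c v t′) → g u t R.≈ g v t′
          compatible isu isv φxy =
            let w  , eq  = faces-of-facet chart is-a (under-a (proj₁ φxy))
                w′ , eq′ = faces-of-facet chart is-b (under-b (Φ-≤τ φxy))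
                corr , onto = facets-correspond G.chart is-a is-b facets-agree
                w″ , eq″ = Correspondence.total corr w
                w″≡w′ = correspondence-determined r corr Φ-faces onto agree eq″ (Φ-resp (sym eq) (sym eq′) φxy)
            in R.Eq.trans (R.Eq.sym (respects is-a isu eq))
                 (R.Eq.trans (subst (λ z → _ R.≈ g (parent b) (fac h z)) w″≡w′ eq″) (respects is-b isv eq′))

      foldSystem : System F Q newLabels c′
      foldSystem = record
        { folded    = folded′
        ; rooted    = rooted
        ; tops      = tops′
        ; elsewhere = elsewhere′
        ; atMostTwo = atMostTwo′
        ; sealed    = sealed′
        }

      foldUniversal : Universal F Q newLabels c′
      foldUniversal {R} {g = g} target ext =
        quotientRespects {R = R} {c = c} {g = g} (respects target ext) (compatible target ext)

  module _ (T T′ : Pseudomanifold d) {F : Forest d} {lab c} (system : System F (Pseudomanifold.facePoset T) lab c)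
           (universal : Universal F (Pseudomanifold.facePoset T) lab c) (pair : FoldPair T T′) where
    open FoldPair pair hiding (F)
    open System system
    open OnManifold T hiding (P)
    private
      ρ = FoldPair.F pair
      P = Pseudomanifold.facePoset T
      Q = Pseudomanifold.facePoset T′

      find-ridge : ∀ {a} → IsBoundary F a → Poset._≤_ P ρ (facetCell {P = P} c a) → ∃[ r ] ridgeCell {P = P} c a r ≡ ρ
      find-ridge bd le with down-⊆ (parent-simplex′ bd) le
      ... | s , sub , eq with corank-two s (trans (cong suc (trans (sym (rank-size system (parent-simplex′ bd)))
                                                                (cong rank eq))) F-dim) (λ {x} → sub {x})
      ...   | r , refl = r , eq

    fold-step : ∃₂ λ lab′ c′ → System F Q lab′ c′ × Universal F Q lab′ c′
    fold-step =
      let a , open-a , a-σ = boundary-facet system σ-dim σ∈∂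
          b , open-b , b-τ = boundary-facet system τ-dim τ∈∂
          r , ridge-a = find-ridge (proj₁ open-a) (subst (Poset._≤_ P ρ) (sym a-σ) F⊑σ)
          s , ridge-b = find-ridge (proj₁ open-b) (subst (Poset._≤_ P ρ) (sym b-τ) F⊑τ)
          ridge-ρ : IsRidge {P = P} c (IsSimplex F) ρ
          ridge-ρ = λ isu eq → trans (cong suc (trans (sym (rank-size system isu)) (cong rank eq))) F-dim
          open Fold T T′ system universal identify σ≢τ open-a open-b a-σ b-τ ridge-a ridge-b ridge-ρ F⊑σ F⊑τ φ-fixes
      in _ , _ , foldSystem , λ {R} {l} {g} → foldUniversal {R} {l} {g}

-- Attaching a simplex

-- The cone over `θ`, a map between the facets opposite to `f` and `g`, with the apex `f` sent to
-- the apex `g`.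
apex-extension : ∀ {n} → Fin (suc n) → Fin (suc n) → (Subset n → Subset n) → Subset (suc n) → Subset (suc n)
apex-extension f g θ s = insertAt (θ (removeAt s f)) g (lookup s f)

apex-extension-insertAt : ∀ {n} (f g : Fin (suc n)) (θ : Subset n → Subset n) w b →
  apex-extension f g θ (insertAt w f b) ≡ insertAt (θ w) g b
apex-extension-insertAt f g θ w b =
  cong₂ (λ w b → insertAt (θ w) g b) (Vec.removeAt-insertAt w f b) (Vec.insertAt-lookup w f b)

apex-extension-embedding : ∀ {n} (f g : Fin (suc n)) {θ : Subset n → Subset n} →
  Embedding θ → Embedding (apex-extension f g θ)
apex-extension-embedding f g {θ} emb = record
  { mono   = λ {s} {t} → mono s t
  ; cancel = λ {s} {t} → cancel s t
  }
  where
  module E = Embedding emb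
  split : ∀ s → insertAt (removeAt s f) f (lookup s f) ≡ s
  split s = Vec.insertAt-removeAt s f
  mono : ∀ s t → s ⊆ t → apex-extension f g θ s ⊆ apex-extension f g θ t
  mono s t sub = insertAt-⊆ g (E.mono (insertAt-⊆⁻ f sub′)) (insertAt-∈⁻ f sub′)
    where
    sub′ : insertAt (removeAt s f) f (lookup s f) ⊆ insertAt (removeAt t f) f (lookup t f)
    sub′ = subst₂ _⊆_ (sym (split s)) (sym (split t)) sub
  cancel : ∀ s t → apex-extension f g θ s ⊆ apex-extension f g θ t → s ⊆ t
  cancel s t sub = subst₂ _⊆_ (split s) (split t)
    (insertAt-⊆ f (E.cancel (insertAt-⊆⁻ g sub)) (insertAt-∈⁻ g sub))

unlabelled : ∀ {d} → Labelling d
unlabelled _ = nothing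

module _ {e : ℕ} where

  private
    d : ℕ
    d = suc e

  -- A target for the enlarged tree need not be covered by the charts of the smaller one, so
  -- `Folded` would not pass down the induction; `Glued` does.
  TreeUniversal : (F : Forest d) (P : Poset 0ℓ 0ℓ 0ℓ) → (Simplex d → Subset (suc d) → Poset.Carrier P) → Set₁
  TreeUniversal F P c = ∀ {R g} → Glued F R g → Respects (IsSimplex F) P R c g

  module _ (T T′ : Pseudomanifold d) where

    private
      P = Pseudomanifold.facePoset T
      Q = Pseudomanifold.facePoset T′
      P⊎Δ = ⊎-poset P (⊆-poset (suc d))

    module Attach {F : Forest d} {c} (system : System F P unlabelled c) (universal : TreeUniversal F P c)
                  {σ τ} {φ : ↓ P⊎Δ (inj₁ σ) ≅ ↓ P⊎Δ (inj₂ τ)} (identify : Identification P⊎Δ φ Q)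
                  {a} (open-a : Unglued F unlabelled a) (a-σ : facetCell {P = P} c a ≡ σ) {g} (g-τ : τ ≡ fac g ⊤)
                  where
      open Gluing identify
      open System system
      private
        module P = Poset P
        module P⊎Δ = Poset P⊎Δ

        is-a : IsSimplex F (parent a)
        is-a = parent-simplex′ (proj₁ open-a)
        f : Fin (suc d)
        f = color a

        under-a : ∀ {x} → x P.≤ σ → x P.≤ facetCell {P = P} c a
        under-a = P.≤-respʳ-≈ (sym a-σ)
        under-σ : ∀ {x} → x P.≤ facetCell {P = P} c a → x P.≤ σ
        under-σ = P.≤-respʳ-≈ a-σ

      F′ : Forest d
      F′ = extend F a

      open Extend F a (proj₁ open-a) using (new-simplex; old-simplex; simplex-cases; boundary-cases; size-extend) public

      private
        Φ₁₂ : Subset d → Subset d → Set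
        Φ₁₂ w w′ = Φ (inj₁ (c (parent a) (fac f w))) (inj₂ (fac g w′))

        Φ₁₂-correspondence : Correspondence Φ₁₂
        Φ₁₂-correspondence = record
          { total  = total
          ; mono   = λ r r′ sub → insertAt-⊆⁻ g (drop-inj₂ (Φ-mono r r′ (inj₁ (mono is-a (fac-⊆ f sub)))))
          ; cancel = λ r r′ sub → insertAt-⊆⁻ f (cancel is-a (drop-inj₁ (Φ-cancel r r′ (inj₂ (fac-⊆ g sub)))))
          }
          where
          total : ∀ w → ∃[ w′ ] Φ₁₂ w w′
          total w with Φ-total (inj₁ (under-σ (mono is-a (fac-⊆ f (⊆-max w)))))
          ... | inj₁ _ , φxy with () ← Φ-≤τ φxy
          ... | inj₂ y , φxy with ⊆-fac g (λ {x} → subst (y ⊆_) g-τ (drop-inj₂ (Φ-≤τ φxy)) {x})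
          ...   | w′ , refl , _ = w′ , φxy

        Φ₁₂-onto : ∀ w′ → ∃[ w ] Φ₁₂ w w′
        Φ₁₂-onto w′ with Φ-onto {inj₂ (fac g w′)} (inj₂ (subst (fac g w′ ⊆_) (sym g-τ) (fac-⊆ g (⊆-max w′))))
        ... | inj₁ x , φxy@(inj₁ x≤σ , _) with faces-of-facet chart is-a (under-a x≤σ)
        ...   | w , refl = w , φxy
        Φ₁₂-onto w′ | inj₂ _ , (() , _)

        module Φ₁₂ = Correspondence Φ₁₂-correspondence

        θ : Subset d → Subset d
        θ w = proj₁ (Φ₁₂.total w)

        -- Chosen so that the new simplex and its neighbour agree on their common facet.
        ψ : Subset (suc d) → Subset (suc d)
        ψ = apex-extension f g θ

        module ψ = Embedding (apex-extension-embedding f g Φ₁₂.embedding)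

        ψ-fac : ∀ w → ψ (fac f w) ≡ fac g (θ w)
        ψ-fac w = apex-extension-insertAt f g θ w _

        ψ-onto : ∀ y → ∃[ s ] ψ s ≡ y
        ψ-onto y with uninsert g y
        ... | w′ , b , refl with Φ₁₂-onto w′
        ...   | w , r = insertAt w f b , trans (apex-extension-insertAt f g θ w b)
                          (cong (λ w → insertAt w g b) (Φ₁₂.functional (proj₂ (Φ₁₂.total w)) r))

        ψ-injective : ∀ {s t} → ψ s ≡ ψ t → s ≡ t
        ψ-injective eq = ⊆-antisym (ψ.cancel (⊆-reflexive eq)) (ψ.cancel (⊆-reflexive (sym eq)))

        ψ-glued : ∀ w → Φ (inj₁ (c (parent a) (fac f w))) (inj₂ (ψ (fac f w)))
        ψ-glued w = Φ-resp P⊎Δ.Eq.refl (inj₂ (sym (ψ-fac w))) (proj₂ (Φ₁₂.total w))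

        ψ-top : ψ (fac f ⊤) ≡ τ
        ψ-top = drop-inj₂ (Φ-functional (ψ-glued ⊤) Φ-στ (inj₁ a-σ))

        c₀ : Simplex d → Subset (suc d) → P⊎Δ.Carrier
        c₀ u s with u ≟ˢ beyond a
        ... | yes _ = inj₂ (ψ s)
        ... | no  _ = inj₁ (c u s)

        data Origin (u : Simplex d) : Set where
          old : IsSimplex F u → (∀ s → c₀ u s P⊎Δ.≈ inj₁ (c u s)) → Origin u
          new : u ≡ beyond a → (∀ s → c₀ u s P⊎Δ.≈ inj₂ (ψ s)) → Origin u

        c₀-old : ∀ {u} → IsSimplex F u → ∀ s → c₀ u s P⊎Δ.≈ inj₁ (c u s)
        c₀-old {u} isu s with u ≟ˢ beyond a
        ... | yes refl = contradiction isu (boundary-≢-interior (proj₁ open-a))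
        ... | no  _    = P⊎Δ.Eq.refl

        c₀-new : ∀ s → c₀ (beyond a) s P⊎Δ.≈ inj₂ (ψ s)
        c₀-new s with beyond a ≟ˢ beyond a
        ... | yes _   = P⊎Δ.Eq.refl
        ... | no  neq = contradiction refl neq

        origin : ∀ {u} → IsSimplex F′ u → Origin u
        origin isu with simplex-cases isu
        ... | inj₁ isu′ = old isu′ (c₀-old isu′)
        ... | inj₂ refl = new refl c₀-new

        ≤-resp : ∀ {x x′ y y′} → x P⊎Δ.≈ x′ → y P⊎Δ.≈ y′ → x P⊎Δ.≤ y → x′ P⊎Δ.≤ y′
        ≤-resp ex ey = P⊎Δ.≤-respˡ-≈ ex ∘ P⊎Δ.≤-respʳ-≈ ey

        chart₀ : Chart (IsSimplex F′) P⊎Δ c₀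
        chart₀ = record { mono = mono₀ ; cancel = cancel₀ ; down = down₀ ; cover = cover₀ }
          where
          ≈-sym = P⊎Δ.Eq.sym
          mono₀ : ∀ {u s t} → IsSimplex F′ u → s ⊆ t → c₀ u s P⊎Δ.≤ c₀ u t
          mono₀ {u} {s} {t} isu sub with origin isu
          ... | old isu′ e = ≤-resp (≈-sym (e s)) (≈-sym (e t)) (inj₁ (mono isu′ sub))
          ... | new _ e    = ≤-resp (≈-sym (e s)) (≈-sym (e t)) (inj₂ (ψ.mono sub))
          cancel₀ : ∀ {u s t} → IsSimplex F′ u → c₀ u s P⊎Δ.≤ c₀ u t → s ⊆ t
          cancel₀ {u} {s} {t} isu le with origin isu
          ... | old isu′ e = cancel isu′ (drop-inj₁ (≤-resp (e s) (e t) le))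
          ... | new _ e    = ψ.cancel (drop-inj₂ (≤-resp (e s) (e t) le))
          down₀ : ∀ {u t x} → IsSimplex F′ u → x P⊎Δ.≤ c₀ u t → ∃[ s ] c₀ u s P⊎Δ.≈ x
          down₀ {u} {t} {x} isu le with origin isu
          down₀ {u} {t} {x} isu le | old isu′ e with x | P⊎Δ.≤-respʳ-≈ (e t) le
          ... | inj₁ x′ | inj₁ le′ = let s , eq = down isu′ le′ in s , P⊎Δ.Eq.trans (e s) (inj₁ eq)
          down₀ {u} {t} {x} isu le | new _ e with x | P⊎Δ.≤-respʳ-≈ (e t) le
          ... | inj₂ y | inj₂ _ = let s , eq = ψ-onto y in s , P⊎Δ.Eq.trans (e s) (inj₂ eq)
          cover₀ : ∀ x → ∃₂ λ u s → IsSimplex F′ u × c₀ u s P⊎Δ.≈ x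
          cover₀ (inj₁ x) = let u , s , isu , eq = cover x
                            in u , s , old-simplex isu , P⊎Δ.Eq.trans (c₀-old isu s) (inj₁ eq)
          cover₀ (inj₂ y) = let s , eq = ψ-onto y
                            in beyond a , s , new-simplex , P⊎Δ.Eq.trans (c₀-new s) (inj₂ eq)

        merged-old : ∀ {x y} → quot (inj₁ x) ≡ quot (inj₁ y) → x ≡ y
        merged-old eq with merged eq
        ... | same (inj₁ eq′) = eq′
        ... | forward h  with () ← Φ-≤τ h
        ... | backward h with () ← Φ-≤τ h

        merged-mixed : ∀ {x y} → quot (inj₁ x) ≡ quot (inj₂ y) → x P.≤ σ
        merged-mixed eq with merged eq
        ... | forward h  = drop-inj₁ (proj₁ h)
        ... | backward h with () ← proj₁ h

      attachChart : Simplex d → Subset (suc d) → Poset.Carrier Q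
      attachChart u = quot ∘ c₀ u

      private
        tops′ : ∀ {u v} → IsSimplex F′ u → IsSimplex F′ v → attachChart u ⊤ ≡ attachChart v ⊤ → u ≡ v
        tops′ isu isv eq with origin isu | origin isv
        ... | old isu′ e | old isv′ e′ = tops isu′ isv′
              (merged-old (trans (sym (quot-cong (e ⊤))) (trans eq (quot-cong (e′ ⊤)))))
        ... | old isu′ e | new _ e′ = contradiction (under-a (merged-mixed
              (trans (sym (quot-cong (e ⊤))) (trans eq (quot-cong (e′ ⊤)))))) (top-not-below isu′ (proj₁ open-a))
        ... | new _ e | old isv′ e′ = contradiction (under-a (merged-mixed
              (trans (sym (quot-cong (e′ ⊤))) (trans (sym eq) (quot-cong (e ⊤)))))) (top-not-below isv′ (proj₁ open-a))
        ... | new u≡ _ | new v≡ _ = trans u≡ (sym v≡)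

        glue′ : Glued F′ Q attachChart
        glue′ {b} isb t with origin isb
        ... | old isb′ e = trans (quot-cong (e _)) (trans (cong (quot ∘ inj₁) (glue isb′ t))
                             (sym (quot-cong (c₀-old (parent-of-interior rooted isb′) _))))
        ... | new refl e = trans (quot-cong (e _)) (trans (sym (glued (ψ-glued t))) (sym (quot-cong (c₀-old is-a _))))

        -- On the disjoint union T ⊎ Δ the facets of Δ, including the one to be glued, are
        -- on the boundary as well.
        Free : Pred (Facet d ⊎ Fin (suc d)) 0ℓ
        Free = [ Unglued F unlabelled , const Unit ]

        facet₀ : Facet d ⊎ Fin (suc d) → P⊎Δ.Carrier
        facet₀ (inj₁ b) = inj₁ (facetCell {P = P} c b)
        facet₀ (inj₂ h) = inj₂ (ψ (fac h ⊤))

        Ridge₀ : Pred P⊎Δ.Carrier 0ℓ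
        Ridge₀ = IsRidge {P = P⊎Δ} c₀ (IsSimplex F′)

        -- All cells above a ridge lie in the same summand as the ridge: in `T` the invariant
        -- applies, in the new simplex the count for a single simplex.
        atMostTwo₀ : AtMostTwo P⊎Δ Ridge₀ Free facet₀
        atMostTwo₀ {inj₁ x} ridge {inj₁ p} {inj₁ q} {inj₁ r} op oq or (inj₁ xp) (inj₁ xq) (inj₁ xr) =
          Sum.map (cong inj₁) (Sum.map (cong inj₁) (cong inj₁)) (atMostTwo ridge′ op oq or xp xq xr)
          where
          ridge′ : IsRidge {P = P} c (IsSimplex F) x
          ridge′ isu eq = ridge (old-simplex isu) (P⊎Δ.Eq.trans (c₀-old isu _) (inj₁ eq))
        atMostTwo₀ {inj₁ x} ridge {inj₂ _} op oq or () xq xr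
        atMostTwo₀ {inj₁ x} ridge {_} {inj₂ _} op oq or xp () xr
        atMostTwo₀ {inj₁ x} ridge {_} {_} {inj₂ _} op oq or xp xq ()
        atMostTwo₀ {inj₂ y} ridge {inj₁ _} op oq or () xq xr
        atMostTwo₀ {inj₂ y} ridge {_} {inj₁ _} op oq or xp () xr
        atMostTwo₀ {inj₂ y} ridge {_} {_} {inj₁ _} op oq or xp xq ()
        atMostTwo₀ {inj₂ y} ridge {inj₂ p} {inj₂ q} {inj₂ r} op oq or (inj₂ xp) (inj₂ xq) (inj₂ xr) with ψ-onto y
        ... | s , refl = Sum.map (cong inj₂) (Sum.map (cong inj₂) (cong inj₂))
                (at-most-two-facets s (ridge new-simplex (c₀-new s)) (ψ.cancel xp) (ψ.cancel xq) (ψ.cancel xr))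

        -- Locates a boundary facet of the enlarged tree before the gluing, the facets of the new
        -- simplex being indexed by colour. Just the two facets glued together, `inj₁ a` and
        -- `inj₂ f`, have no such place.
        data Place (b : Facet d) (j : Facet d ⊎ Fin (suc d)) : Set where
          old : IsBoundary F b → b ≢ a → j ≡ inj₁ b → Place b j
          new : ∀ i → b ≡ beyond a ▹ i → j ≡ inj₂ (color b) → Place b j

        place : ∀ {b} → IsBoundary F′ b → ∃ (Place b)
        place {b} bd with boundary-cases bd
        ... | inj₁ (bd′ , b≢a) = inj₁ b , old bd′ b≢a refl
        ... | inj₂ (i , eq)    = inj₂ (color b) , new i eq refl

        place-injective : ∀ {b b′ j j′} → Place b j → Place b′ j′ → j ≡ j′ → b ≡ b′
        place-injective (old _ _ refl) (old _ _ refl) refl = refl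
        place-injective {b} {b′} (new i eq refl) (new i′ eq′ refl) colors =
          facet-unique b b′ (trans (cong parent eq) (sym (cong parent eq′))) (Sum.inj₂-injective colors)
        place-injective (old _ _ refl) (new _ _ refl) ()
        place-injective (new _ _ refl) (old _ _ refl) ()

        place-remains : ∀ {b j} → Place b j → Free j × j ≢ inj₁ a × j ≢ inj₂ f
        place-remains (old bd b≢a refl) = (bd , refl) , b≢a ∘ Sum.inj₁-injective , λ ()
        place-remains (new i refl refl) = tt , (λ ()) , Fin.punchInᵢ≢i f i ∘ Sum.inj₂-injective

        place-facet : ∀ {b j} → Place b j → facetCell {P = Q} attachChart b ≡ quot (facet₀ j)
        place-facet (old bd _ refl)   = quot-cong (c₀-old (parent-simplex′ bd) _)
        place-facet (new i refl refl) = quot-cong (c₀-new _)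

        atMostTwo′ : AtMostTwo Q (IsRidge {P = Q} attachChart (IsSimplex F′)) (Unglued F′ unlabelled)
                               (facetCell {P = Q} attachChart)
        atMostTwo′ ridge (bp , _) (bq , _) (br , _) xp xq xr =
          let _ , p′ = place bp
              _ , q′ = place bq
              _ , r′ = place br
          in Sum.map (place-injective p′ q′) (Sum.map (place-injective q′ r′) (place-injective p′ r′))
            (quotientAtMostTwo {Ridge = Ridge₀} {Ridge′ = IsRidge {P = Q} attachChart (IsSimplex F′)}
              (λ ridge′ eq isu eq′ → ridge′ isu (trans (quot-cong eq′) eq)) {Open = Free} {facet = facet₀} atMostTwo₀
              {inj₁ a} {inj₂ f} open-a tt (inj₁ a-σ) (inj₂ ψ-top) ridge
              (place-remains p′) (place-remains q′) (place-remains r′)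
              (subst (Poset._≤_ Q _) (place-facet p′) xp) (subst (Poset._≤_ Q _) (place-facet q′) xq)
              (subst (Poset._≤_ Q _) (place-facet r′) xr))

      attachSystem : System F′ Q unlabelled attachChart
      attachSystem = record
        { folded    = record { chart = quotientChart chart₀ ; glue = glue′ ; matched = λ _ _ () }
        ; rooted    = old-simplex rooted
        ; tops      = tops′
        ; elsewhere = λ _ ()
        ; atMostTwo = atMostTwo′
        ; sealed    = λ _ ()
        }

      attachUniversal : TreeUniversal F′ Q attachChart
      attachUniversal {R} {h} glue-h = quotientRespects {R = R} {c = c₀} {g = h} respects₀ compatible
        where
        module R = Poset R
        respects : Respects (IsSimplex F) P R c h
        respects = universal {R} (λ isa → glue-h (old-simplex isa))
        respects₀ : Respects (IsSimplex F′) P⊎Δ R c₀ h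
        respects₀ {s = s} {t} isu isv eq with origin isu | origin isv
        ... | old isu′ e | old isv′ e′ =
          respects isu′ isv′ (drop-inj₁ (P⊎Δ.Eq.trans (P⊎Δ.Eq.sym (e s)) (P⊎Δ.Eq.trans eq (e′ t))))
        ... | old _ e | new _ e′ with () ← P⊎Δ.Eq.trans (P⊎Δ.Eq.sym (e s)) (P⊎Δ.Eq.trans eq (e′ t))
        ... | new _ e | old _ e′ with () ← P⊎Δ.Eq.trans (P⊎Δ.Eq.sym (e s)) (P⊎Δ.Eq.trans eq (e′ t))
        ... | new refl e | new refl e′ = R.Eq.reflexive (cong (h (beyond a))
          (ψ-injective (drop-inj₂ (P⊎Δ.Eq.trans (P⊎Δ.Eq.sym (e s)) (P⊎Δ.Eq.trans eq (e′ t))))))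
        compatible : ∀ {u v s t} → IsSimplex F′ u → IsSimplex F′ v → Φ (c₀ u s) (c₀ v t) → h u s R.≈ h v t
        compatible {s = s} {t} isu isv φxy with origin isu | origin isv
        ... | _ | old _ e with () ← P⊎Δ.≤-respˡ-≈ (e t) (Φ-≤τ φxy)
        ... | new _ e | new _ _ with () ← P⊎Δ.≤-respˡ-≈ (e s) (proj₁ φxy)
        ... | old isu′ e | new refl e′ with P⊎Δ.≤-respˡ-≈ (e s) (proj₁ φxy)
        ...   | inj₁ le with faces-of-facet chart is-a (under-a le)
        -- `ψ` reproduces `φ` on the common facet, so `t` must be the face with the same colours as
        -- its partner, and `glue-h` compares exactly such faces.
        ...     | w , eq with ψ-injective {fac f w} {t} (drop-inj₂ (Φ-functional
                                (ψ-glued w) (Φ-resp (e s) (e′ t) φxy) (inj₁ eq)))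
        ...       | refl = R.Eq.trans (respects isu′ is-a (sym eq)) (R.Eq.sym (glue-h new-simplex w))

  attach-step : ∀ {T T′ : Pseudomanifold d} {F c} → System F (Pseudomanifold.facePoset T) unlabelled c →
    TreeUniversal F (Pseudomanifold.facePoset T) c → AttachSimplex T T′ →
    ∃₂ λ F′ c′ → size F′ ≡ suc (size F) ×
      System F′ (Pseudomanifold.facePoset T′) unlabelled c′ × TreeUniversal F′ (Pseudomanifold.facePoset T′) c′
  attach-step {T} {T′} {c = c} system universal attached =
    let a , open-a , a-σ = OnManifold.boundary-facet T system σ-dim σ∈∂
        g , g-τ = corank-one τ τ-dim
        open Attach T T′ {c = c} system (λ {R} {h} → universal {R} {h}) identify open-a a-σ g-τ
    in _ , _ , size-extend , attachSystem , λ {R} {h} → attachUniversal {R} {h}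
    where open AttachSimplex attached

-- Running through a local construction

module _ {e : ℕ} where

  private
    d : ℕ
    d = suc e

  record Grown (T : Pseudomanifold d) (n : ℕ) : Set₁ where
    field
      {forest}  : Forest d
      {chart}   : Simplex d → Subset (suc d) → Pseudomanifold.Cell T
      size≡     : size forest ≡ n
      system    : System forest (Pseudomanifold.facePoset T) unlabelled chart
      universal : TreeUniversal forest (Pseudomanifold.facePoset T) chart

  grown-simplex : ∀ T → Pseudomanifold.facePoset T ≅ ⊆-poset (suc d) → Grown T 1
  grown-simplex T iso = record
    { forest = initial
    ; chart  = c
    ; size≡  = trans (ℕ.+-identityʳ _) (cong suc (nodes*-replicate d))
    ; system = record
      { folded    = record { chart = chart ; glue = λ isa → case initial-only-root isa of λ () ; matched = λ _ _ () }
      ; rooted    = simplex refl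
      ; tops      = λ isu isv _ → trans (initial-only-root isu) (sym (initial-only-root isv))
      ; elsewhere = λ _ ()
      ; atMostTwo = atMostTwo
      ; sealed    = λ _ ()
      }
    ; universal = λ {R} _ isu isv eq → universal {R} (initial-only-root isu) (initial-only-root isv) eq
    }
    where
    module I = Isomorphism iso
    P = Pseudomanifold.facePoset T
    module P = Poset P
    c : Simplex d → Subset (suc d) → P.Carrier
    c _ s = proj₁ (I.preimage-of s)
    to-c : ∀ s → I.to (c root s) ≡ s
    to-c s = proj₂ (I.preimage-of s)
    mono : ∀ {s t} → s ⊆ t → c root s P.≤ c root t
    mono {s} {t} sub = I.cancel (subst₂ _⊆_ (sym (to-c s)) (sym (to-c t)) sub)
    cancel : ∀ {s t} → c root s P.≤ c root t → s ⊆ t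
    cancel {s} {t} le = subst₂ _⊆_ (to-c s) (to-c t) (I.mono le)
    chart : Chart (IsSimplex initial) P c
    chart = record
      { mono   = λ _ → mono
      ; cancel = λ _ → cancel
      ; down   = λ {_} {_} {x} _ _ → I.to x , I.injective (to-c (I.to x))
      ; cover  = λ x → root , I.to x , simplex refl , I.injective (to-c (I.to x))
      }
    atMostTwo : AtMostTwo P (IsRidge {P = P} c (IsSimplex initial)) (Unglued initial unlabelled) (facetCell {P = P} c)
    atMostTwo {x} ridge {p} {q} {r} (bp , _) (bq , _) (br , _) xp xq xr =
      Sum.map (same bp bq) (Sum.map (same bq br) (same bp br))
        (at-most-two-facets (I.to x) (ridge {root} (simplex refl) x≡) (below xp) (below xq) (below xr))
      where
      x≡ : c root (I.to x) ≡ x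
      x≡ = I.injective (to-c (I.to x))
      below : ∀ {t} → x P.≤ c root t → I.to x ⊆ t
      below le = cancel (subst (P._≤ _) (sym x≡) le)
      same : ∀ {p q} → IsBoundary initial p → IsBoundary initial q → color p ≡ color q → p ≡ q
      same bp bq = facet-unique _ _ (trans (initial-only-root (parent-of-boundary (simplex refl) bp))
                                       (sym (initial-only-root (parent-of-boundary (simplex refl) bq))))
    universal : ∀ {R : Poset 0ℓ 0ℓ 0ℓ} {g : Simplex d → Subset (suc d) → Poset.Carrier R} {u v s t} →
                u ≡ root → v ≡ root → c u s ≡ c v t → Poset._≈_ R (g u s) (g v t)
    universal {R} {g} refl refl eq = Poset.Eq.reflexive R
      (cong (g root) (trans (sym (to-c _)) (trans (cong I.to eq) (to-c _))))

  grown-attach : ∀ {T T′ n} → Grown T n → AttachSimplex T T′ → Grown T′ (suc n)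
  grown-attach {T} {T′} G attached =
    let open Grown G
        F′ , c′ , size′ , system′ , universal′ = attach-step {T = T} {T′} system (λ {R} {g} → universal {R} {g}) attached
    in record
      { size≡     = trans size′ (cong suc size≡)
      ; system    = system′
      ; universal = λ {R} {g} → universal′ {R} {g}
      }

  record Presented (T : Pseudomanifold d) (n : ℕ) : Set₁ where
    field
      {forest}  : Forest d
      {labelling} : Labelling d
      {chart}   : Simplex d → Subset (suc d) → Pseudomanifold.Cell T
      size≡     : size forest ≡ n
      system    : System forest (Pseudomanifold.facePoset T) labelling chart
      universal : Universal forest (Pseudomanifold.facePoset T) labelling chart

  presented-grown : ∀ {T n} → Grown T n → Presented T n
  presented-grown G = record
    { size≡     = size≡
    ; system    = system
    ; universal = λ {R} {_} {g} target _ → universal {R} {g} (Folded.glue target)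
    }
    where open Grown G

  presented-fold : ∀ {T T′ n} → Presented T n → FoldPair T T′ → Presented T′ n
  presented-fold {T} {T′} p pair =
    let open Presented p
        lab′ , c′ , system′ , universal′ = fold-step T T′ system (λ {R} {l} {g} → universal {R} {l} {g}) pair
    in record
      { size≡     = size≡
      ; system    = system′
      ; universal = λ {R} {l} {g} → universal′ {R} {l} {g}
      }

  presentation : ∀ {C} (construction : LocalConstruction d C) → 1 ≤ #facets d C →
    Presented (LocalConstruction.T construction (LocalConstruction.k construction)) (#facets d C)
  presentation {C} construction 1≤N = folds (ℕ.≤⇒≤′ N≤k) ℕ.≤-refl
    where
    open LocalConstruction construction
    N = #facets d C
    attachments : ∀ {i} → 1 ≤′ i → i ≤ N → Grown (T i) i
    attachments ≤′-refl        _   = grown-simplex (T 1) start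
    attachments (≤′-step 1≤′i) i<N = grown-attach (attachments 1≤′i (ℕ.<⇒≤ i<N)) (attach _ (ℕ.≤′⇒≤ 1≤′i) i<N)
    folds : ∀ {i} → N ≤′ i → i ≤ k → Presented (T i) N
    folds ≤′-refl        _   = presented-grown (attachments (ℕ.≤⇒≤′ 1≤N) ℕ.≤-refl)
    folds (≤′-step N≤′i) i<k = presented-fold (folds N≤′i (ℕ.<⇒≤ i<k)) (fold _ (ℕ.≤′⇒≤ N≤′i) i<k)

-- From face posets back to simplicial complexes

⁅⁆⊆ : ∀ {n x} {p : Subset n} → x ∈ p → ⁅ x ⁆ ⊆ p
⁅⁆⊆ x∈p y∈⁅x⁆ with refl ← x∈⁅y⁆⇒x≡y _ y∈⁅x⁆ = x∈p

record FaceCorrespondence (C D : SimplicialComplex)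
    (R : Subset (SimplicialComplex.#vertices C) → Subset (SimplicialComplex.#vertices D) → Set) : Set where
  private
    module C = SimplicialComplex C
    module D = SimplicialComplex D
  field
    left   : ∀ {s t} → R s t → C.Face s
    right  : ∀ {s t} → R s t → D.Face t
    total  : ∀ {s} → C.Face s → ∃[ t ] R s t
    onto   : ∀ {t} → D.Face t → ∃[ s ] R s t
    mono   : ∀ {s s′ t t′} → R s t → R s′ t′ → s ⊆ s′ → t ⊆ t′
    cancel : ∀ {s s′ t t′} → R s t → R s′ t′ → t ⊆ t′ → s ⊆ s′

  empty-total : ∃[ t ] R ⊥ t × (∀ {x} → ¬ x ∈ t)
  empty-total =
    let t , r  = total C.∅-face
        _ , r′ = onto D.∅-face
    in t , r , λ x∈t → ∉⊥ (mono r r′ (⊆-min _) x∈t)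

  -- Vertices are the atoms of the face poset.
  vertex-image : ∀ v → ∃[ w ] R ⁅ v ⁆ ⁅ w ⁆
  vertex-image v with total (C.vertex v)
  ... | t , r with nonempty? t
  ...   | no empty = contradiction
            (cancel r (proj₁ (proj₂ empty-total)) (λ x∈t → contradiction (_ , x∈t) empty) (x∈⁅x⁆ v)) ∉⊥
  ...   | yes (w , w∈t) with onto (D.vertex w)
  ...     | s , r′ with nonempty? s
  ...       | no empty = contradiction
                (mono r′ (proj₁ (proj₂ empty-total)) (λ x∈s → contradiction (_ , x∈s) empty) (x∈⁅x⁆ w))
                (proj₂ (proj₂ empty-total))
  ...       | yes (x , x∈s) = w , subst (R ⁅ v ⁆) (⊆-antisym t⊆⁅w⁆ ⁅w⁆⊆t) r
    where
    ⁅w⁆⊆t : ⁅ w ⁆ ⊆ t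
    ⁅w⁆⊆t = ⁅⁆⊆ w∈t
    v∈s : v ∈ s
    v∈s with refl ← x∈⁅y⁆⇒x≡y v (cancel r′ r ⁅w⁆⊆t x∈s) = x∈s
    t⊆⁅w⁆ : t ⊆ ⁅ w ⁆
    t⊆⁅w⁆ = mono r r′ (⁅⁆⊆ v∈s)

flipped : ∀ {C D R} → FaceCorrespondence C D R → FaceCorrespondence D C (flip R)
flipped corr = record
  { left = right ; right = left ; total = onto ; onto = total ; mono = cancel ; cancel = mono }
  where open FaceCorrespondence corr

-- The vertices determine where a face goes. One inclusion between a set and the partner of a face
-- is enough each time, since subsets of faces are faces.
correspondence⇒isomorphic : ∀ {C D R} → FaceCorrespondence C D R → Isomorphic C D
correspondence⇒isomorphic {C} {D} {R} corr = π , λ s → mk⇔ (toFace s) (fromFace s)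
  where
  open FaceCorrespondence corr
  module C = SimplicialComplex C
  module D = SimplicialComplex D
  to : Fin C.#vertices → Fin D.#vertices
  to v = proj₁ (vertex-image v)
  to-R : ∀ v → R ⁅ v ⁆ ⁅ to v ⁆
  to-R v = proj₂ (vertex-image v)
  from : Fin D.#vertices → Fin C.#vertices
  from w = proj₁ (FaceCorrespondence.vertex-image (flipped corr) w)
  from-R : ∀ w → R ⁅ from w ⁆ ⁅ w ⁆
  from-R w = proj₂ (FaceCorrespondence.vertex-image (flipped corr) w)
  to∘from : ∀ w → to (from w) ≡ w
  to∘from w = x∈⁅y⁆⇒x≡y w (mono (to-R (from w)) (from-R w) ⊆-refl (x∈⁅x⁆ _))
  from∘to : ∀ v → from (to v) ≡ v
  from∘to v = x∈⁅y⁆⇒x≡y v (cancel (from-R (to v)) (to-R v) ⊆-refl (x∈⁅x⁆ _))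
  π : Permutation C.#vertices D.#vertices
  π = permutation to from to∘from from∘to
  forth : ∀ {s t v} → R s t → v ∈ s → to v ∈ t
  forth r v∈s = mono (to-R _) r (⁅⁆⊆ v∈s) (x∈⁅x⁆ _)
  back : ∀ {s t v} → R s t → to v ∈ t → v ∈ s
  back r w∈t = cancel (to-R _) r (⁅⁆⊆ w∈t) (x∈⁅x⁆ _)
  preimage-∈ : ∀ t {v} → v ∈ preimage to t → to v ∈ t
  preimage-∈ t {v} v∈ = Vec.lookup⇒[]= (to v) t (trans (sym (Vec.lookup∘tabulate (lookup t ∘ to) v)) (Vec.[]=⇒lookup v∈))
  ∈-preimage : ∀ t {v} → to v ∈ t → v ∈ preimage to t
  ∈-preimage t {v} w∈ = Vec.lookup⇒[]= v _ (trans (Vec.lookup∘tabulate (lookup t ∘ to) v) (Vec.[]=⇒lookup w∈))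
  fromFace : ∀ t → D.Face t → C.Face (preimage to t)
  fromFace t face = let s , r = onto face
    in C.downClosed (λ {v} v∈ → back r (preimage-∈ t v∈)) (left r)
  toFace : ∀ t → C.Face (preimage to t) → D.Face t
  toFace t face = let t′ , r = total face
    in D.downClosed (λ {w} w∈t → subst (_∈ t′) (to∘from w)
         (forth r (∈-preimage t (subst (_∈ t) (sym (to∘from w)) w∈t)))) (right r)

module _ {d} {IsS : Simplex d → Set} {P Q : Poset 0ℓ 0ℓ 0ℓ} {c g} (chart : Chart IsS P c) (chart′ : Chart IsS Q g)
         (respects : Respects IsS P Q c g) where

  -- A cell below one charted by `v` is itself charted by `v`, so the inequality splits into a
  -- coincidence of cells and an inclusion of faces.
  respects-≤ : ∀ {u v s t} → IsS u → IsS v → Poset._≤_ P (c u s) (c v t) → Poset._≤_ Q (g u s) (g v t)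
  respects-≤ isu isv le =
    let t′ , sub , eq = Chart.down-⊆ chart isv le
    in Poset.≤-respˡ-≈ Q (respects isv isu eq) (Chart.mono chart′ isv sub)

module _ {d} {IsS : Simplex d → Set} {P Q : Poset 0ℓ 0ℓ 0ℓ} {c g} (chart : Chart IsS P c) (chart′ : Chart IsS Q g)
         (respects : Respects IsS P Q c g) (respects′ : Respects IsS Q P g c)
         {C D : SimplicialComplex} (isoC : P ≅ SimplicialComplex.facePoset C)
         (isoD : Q ≅ SimplicialComplex.facePoset D) where

  private
    module C = SimplicialComplex C
    module D = SimplicialComplex D
    module I = Isomorphism isoC
    module J = Isomorphism isoD

    data R : Subset C.#vertices → Subset D.#vertices → Set where
      at : ∀ {u s} → IsS u → R (proj₁ (I.to (c u s))) (proj₁ (J.to (g u s)))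

  -- Partners are the images of the same face of the same address; the two hypotheses on
  -- coincidences make this an order isomorphism.
  charts⇒isomorphic : Isomorphic C D
  charts⇒isomorphic = correspondence⇒isomorphic {C} {D} {R} record
    { left   = λ { (at {u} {s} isu) → proj₂ (I.to (c u s)) }
    ; right  = λ { (at {u} {s} isu) → proj₂ (J.to (g u s)) }
    ; total  = total
    ; onto   = onto
    ; mono   = λ { (at isu) (at isv) sub → J.mono (respects-≤ chart chart′ respects isu isv (I.cancel sub)) }
    ; cancel = λ { (at isu) (at isv) sub → I.mono (respects-≤ chart′ chart respects′ isu isv (J.cancel sub)) }
    }
    where
    total : ∀ {s} → C.Face s → ∃[ t ] R s t
    total {s} face =
      let x , eq = I.preimage-of (s , face)
          u , s′ , isu , eq′ = Chart.cover chart x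
      in proj₁ (J.to (g u s′)) , subst (λ s → R s (proj₁ (J.to (g u s′)))) (trans (I.cong eq′) eq) (at isu)
    onto : ∀ {t} → D.Face t → ∃[ s ] R s t
    onto {t} face =
      let x , eq = J.preimage-of (t , face)
          u , s′ , isu , eq′ = Chart.cover chart′ x
      in proj₁ (I.to (c u s′)) , subst (R (proj₁ (I.to (c u s′)))) (trans (J.cong eq′) eq) (at isu)

-- Counting

module _ {a} {A : Set a} {m} {f : A → Fin m} (f-injective : ∀ {x y} → f x ≡ f y → x ≡ y) where

  listToFin : ∀ {n} (xs : List A) → length xs ≡ n → Fin (m ^ n)
  listToFin xs eq = vecToFin f (Vec.cast eq (Vec.fromList xs))

  listToFin-injective : ∀ {n} {xs ys : List A} (p : length xs ≡ n) (q : length ys ≡ n) →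
                        listToFin xs p ≡ listToFin ys q → xs ≡ ys
  listToFin-injective {xs = xs} {ys} p q eq = begin
    xs                                          ≡⟨ toList-vec xs p ⟨
    Vec.toList (Vec.cast p (Vec.fromList xs))   ≡⟨ cong Vec.toList (vecToFin-injective f-injective eq) ⟩
    Vec.toList (Vec.cast q (Vec.fromList ys))   ≡⟨ toList-vec ys q ⟩
    ys                                          ∎
    where
    open ≡-Reasoning
    toList-vec : ∀ {n} xs (p : length xs ≡ n) → Vec.toList (Vec.cast p (Vec.fromList xs)) ≡ xs
    toList-vec xs p = trans (Vec.toList-cast p (Vec.fromList xs)) (Vec.toList∘fromList xs)

bit : Bool → Fin 2
bit false = zero
bit true  = suc zero

bit-injective : ∀ {b c} → bit b ≡ bit c → b ≡ c
bit-injective {false} {false} _ = refl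
bit-injective {true}  {true}  _ = refl

labelToFin : ∀ {d} → Maybe (Fin d) → Fin (suc d)
labelToFin nothing  = zero
labelToFin (just r) = suc r

labelToFin-injective : ∀ {d} {x y : Maybe (Fin d)} → labelToFin x ≡ labelToFin y → x ≡ y
labelToFin-injective {x = nothing} {nothing} _    = refl
labelToFin-injective {x = just _}  {just _}  refl = refl

module _ {d : ℕ} where

  -- Decodes a location, undoing `locˢ`: the leaves of a tree are listed by words, whereas labels
  -- are attached to addresses.
  simplexAt : Simplex d → Word {d} → Simplex d
  simplexAt u []      = u
  simplexAt u (i ∷ w) = simplexAt (beyond (u ▹ i)) w

  simplexAt-∷ʳ : ∀ u w i → simplexAt u (w ∷ʳ i) ≡ beyond (simplexAt u w ▹ i)
  simplexAt-∷ʳ u []      i = refl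
  simplexAt-∷ʳ u (j ∷ w) i = simplexAt-∷ʳ (beyond (u ▹ j)) w i

  base : Bool → Simplex d
  base true  = root
  base false = beyond opposite

  simplexAt-loc : ∀ u → simplexAt (base (proj₁ (locˢ u))) (proj₂ (locˢ u)) ≡ u
  simplexAt-loc root              = refl
  simplexAt-loc (beyond opposite) = refl
  simplexAt-loc (beyond (u ▹ i))  = trans (simplexAt-∷ʳ _ (proj₂ (locˢ u)) i)
                                      (cong (λ v → beyond (v ▹ i)) (simplexAt-loc u))

  labelˢ : Labelling d → Simplex d → Maybe (Fin d)
  -- A default, as no facet has the location of the root.
  labelˢ lab root       = nothing
  labelˢ lab (beyond a) = lab a

  labelAt : Labelling d → Bool → Word {d} → Maybe (Fin d)
  labelAt lab b w = labelˢ lab (simplexAt (base b) w)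

  forestShape : Forest d → List Bool
  forestShape F = shape (F ! true) ++ shape (F ! false)

  forestShape-injective : ∀ F G → forestShape F ≡ forestShape G → F ≡ G
  forestShape-injective (t ⊹ u) (t′ ⊹ u′) eq with shape-injective t t′ eq
  ... | refl , eq′ with shape-injective u u′ {[]} {[]}
                       (trans (List.++-identityʳ _) (trans eq′ (sym (List.++-identityʳ _))))
  ...   | refl , _ = refl

  forestLabels : Forest d → Labelling d → List (Maybe (Fin d))
  forestLabels F lab = labels (F ! true) (labelAt lab true) ++ labels (F ! false) (labelAt lab false)

  forestLabels-injective : ∀ F {lab lab′} → forestLabels F lab ≡ forestLabels F lab′ →
                           ∀ {a} → IsBoundary F a → lab a ≡ lab′ a
  forestLabels-injective F {lab} {lab′} eq {a} (boundary l) = begin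
    lab a                                                   ≡⟨ cong (labelˢ lab) (simplexAt-loc (beyond a)) ⟨
    labelAt lab (proj₁ (loc a)) (proj₂ (loc a))             ≡⟨ agree (proj₁ (loc a)) (proj₂ (loc a)) l ⟩
    labelAt lab′ (proj₁ (loc a)) (proj₂ (loc a))            ≡⟨ cong (labelˢ lab′) (simplexAt-loc (beyond a)) ⟩
    lab′ a                                                  ∎
    where
    open ≡-Reasoning
    parts : labels (F ! true) (labelAt lab true) ≡ labels (F ! true) (labelAt lab′ true) ×
            labels (F ! false) (labelAt lab false) ≡ labels (F ! false) (labelAt lab′ false)
    parts = ++-injective {as = labels (F ! true) (labelAt lab true)} {labels (F ! true) (labelAt lab′ true)}
              (trans (length-labels (F ! true) (labelAt lab true))
                     (sym (length-labels (F ! true) (labelAt lab′ true)))) eq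
    agree : ∀ b w → look (F ! b) w ≡ leaf → labelAt lab b w ≡ labelAt lab′ b w
    agree true  = labels-injective (F ! true) (proj₁ parts)
    agree false = labels-injective (F ! false) (proj₂ parts)

module _ {e : ℕ} where

  private
    d : ℕ
    d = suc e

  length-forestShape : ∀ (F : Forest d) → length (forestShape F) ≡ d * size F + 2
  length-forestShape (t ⊹ u) = begin
    length (shape t ++ shape u)                                     ≡⟨ List.length-++ (shape t) ⟩
    length (shape t) + length (shape u)                             ≡⟨ cong₂ _+_ (length-shape t) (length-shape u) ⟩
    (nodes t + leaves t) + (nodes u + leaves u)
      ≡⟨ cong₂ (λ x y → (nodes t + x) + (nodes u + y)) (leaves-nodes t) (leaves-nodes u) ⟩
    (nodes t + (e * nodes t + 1)) + (nodes u + (e * nodes u + 1))   ≡⟨ collect e (nodes t) (nodes u) ⟩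
    d * (nodes t + nodes u) + 2                                     ∎
    where
    open ≡-Reasoning
    collect : ∀ e m n → (m + (e * m + 1)) + (n + (e * n + 1)) ≡ suc e * (m + n) + 2
    collect = solve-∀

  length-forestLabels : ∀ (F : Forest d) lab → length (forestLabels F lab) ≡ e * size F + 2
  length-forestLabels (t ⊹ u) lab = begin
    length (labels t _ ++ labels u _)              ≡⟨ List.length-++ (labels t _) ⟩
    length (labels t _) + length (labels u _)      ≡⟨ cong₂ _+_ (length-labels t _) (length-labels u _) ⟩
    leaves t + leaves u                            ≡⟨ cong₂ _+_ (leaves-nodes t) (leaves-nodes u) ⟩
    (e * nodes t + 1) + (e * nodes u + 1)          ≡⟨ collect e (nodes t) (nodes u) ⟩
    e * (nodes t + nodes u) + 2                    ∎
    where
    open ≡-Reasoning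
    collect : ∀ e m n → (e * m + 1) + (e * n + 1) ≡ e * (m + n) + 2
    collect = solve-∀

  Code : ℕ → Set
  Code N = Fin (2 ^ (d * N + 2) * suc d ^ (e * N + 2))

  private
    shapeLength : ∀ {N} (F : Forest d) → size F ≡ N → length (forestShape F) ≡ d * N + 2
    shapeLength F refl = length-forestShape F

    labelsLength : ∀ {N} (F : Forest d) lab → size F ≡ N → length (forestLabels F lab) ≡ e * N + 2
    labelsLength F lab refl = length-forestLabels F lab

  shapeCode : ∀ {N} (F : Forest d) → size F ≡ N → Fin (2 ^ (d * N + 2))
  shapeCode F eq = listToFin bit-injective (forestShape F) (shapeLength F eq)

  labelCode : ∀ {N} (F : Forest d) → Labelling d → size F ≡ N → Fin (suc d ^ (e * N + 2))
  labelCode F lab eq = listToFin labelToFin-injective (forestLabels F lab) (labelsLength F lab eq)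

  code : ∀ {N} (F : Forest d) → Labelling d → size F ≡ N → Code N
  code F lab eq = combine (shapeCode F eq) (labelCode F lab eq)

  code-injective : ∀ {N} F G {lab lab′} (p : size F ≡ N) (q : size G ≡ N) → code F lab p ≡ code G lab′ q →
                   F ≡ G × (∀ {a} → IsBoundary F a → lab a ≡ lab′ a)
  code-injective {N} F G {lab} {lab′} p q eq =
    F≡G , forestLabels-injective F (subst (λ H → forestLabels F lab ≡ forestLabels H lab′) (sym F≡G)
            (listToFin-injective labelToFin-injective {n = e * N + 2}
              (labelsLength F lab p) (labelsLength G lab′ q) (proj₂ parts)))
    where
    parts : shapeCode F p ≡ shapeCode G q × labelCode F lab p ≡ labelCode G lab′ q
    parts = Fin.combine-injective {2 ^ (d * N + 2)} {suc d ^ (e * N + 2)}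
              (shapeCode F p) (labelCode F lab p) (shapeCode G q) (labelCode G lab′ q) eq
    F≡G : F ≡ G
    F≡G = forestShape-injective F G
      (listToFin-injective bit-injective {n = d * N + 2} (shapeLength F p) (shapeLength G q) (proj₁ parts))

  presentedCode : ∀ {T N} → Presented {e} T N → Code N
  presentedCode p = code forest labelling size≡
    where open Presented p

  -- Equal codes mean the same forest and the same labels on its boundary facets, so each complex is
  -- a target for the universality of the other.
  same-code⇒isomorphic : ∀ {S T N} (p : Presented {e} S N) (q : Presented {e} T N) →
    presentedCode p ≡ presentedCode q →
    ∀ {C D} → Pseudomanifold.facePoset S ≅ SimplicialComplex.facePoset C →
    Pseudomanifold.facePoset T ≅ SimplicialComplex.facePoset D → Isomorphic C D
  same-code⇒isomorphic p q eq {C} {D} isoC isoD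
    with code-injective (Presented.forest p) (Presented.forest q) (Presented.size≡ p) (Presented.size≡ q) eq
  same-code⇒isomorphic
    record { system = system ; universal = universal } record { system = system′ ; universal = universal′ }
    eq {C} {D} isoC isoD | refl , agree =
    charts⇒isomorphic (System.chart system) (System.chart system′)
      (universal (System.folded system′) (λ bd l → trans (sym (agree bd)) l))
      (universal′ (System.folded system) (λ bd l → trans (agree bd) l)) {C} {D} isoC isoD

-- Numerical estimates

-- Here d is `2 + e`. Equality holds at d = 2, and the inequality fails at d = 1.
linear-vs-exponential : ∀ e → 4 * (3 + e) ≤ 3 * 2 ^ (2 + e)
linear-vs-exponential zero    = ℕ.≤-refl
linear-vs-exponential (suc e) = begin
  4 * (4 + e)                   ≤⟨ ℕ.m≤m+n _ (8 + 4 * e) ⟩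
  4 * (4 + e) + (8 + 4 * e)     ≡⟨ double e ⟩
  2 * (4 * (3 + e))             ≤⟨ ℕ.*-monoʳ-≤ 2 (linear-vs-exponential e) ⟩
  2 * (3 * 2 ^ (2 + e))         ≡⟨ swap (2 ^ (2 + e)) ⟩
  3 * 2 ^ (3 + e)               ∎
  where
  open ℕ.≤-Reasoning
  double : ∀ e → 4 * (4 + e) + (8 + 4 * e) ≡ 2 * (4 * (3 + e))
  double = solve-∀
  swap : ∀ x → 2 * (3 * x) ≡ 3 * (2 * x)
  swap = solve-∀

-- Bernoulli's inequality 1 + m/3 ≤ (4/3)^m with denominators cleared.
bernoulli : ∀ m → (3 + m) * 3 ^ m ≤ 3 * 4 ^ m
bernoulli zero    = ℕ.≤-refl
bernoulli (suc m) = begin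
  (4 + m) * (3 * 3 ^ m)                  ≤⟨ ℕ.m≤m+n _ (m * 3 ^ m) ⟩
  (4 + m) * (3 * 3 ^ m) + m * 3 ^ m      ≡⟨ regroup m (3 ^ m) ⟩
  4 * ((3 + m) * 3 ^ m)                  ≤⟨ ℕ.*-monoʳ-≤ 4 (bernoulli m) ⟩
  4 * (3 * 4 ^ m)                        ≡⟨ swap (4 ^ m) ⟩
  3 * (4 * 4 ^ m)                        ∎
  where
  open ℕ.≤-Reasoning
  regroup : ∀ m x → (4 + m) * (3 * x) + m * x ≡ 4 * ((3 + m) * x)
  regroup = solve-∀
  swap : ∀ x → 4 * (3 * x) ≡ 3 * (4 * x)
  swap = solve-∀

-- For m ≥ 12K one has 4K ≤ m/3 ≤ (4/3)^m; this is where the 12 of the threshold comes from.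
absorb : ∀ K m → 12 * K ≤ m → 4 * K * 3 ^ m ≤ 4 ^ m
absorb K m le = ℕ.*-cancelˡ-≤ 3 (begin
  3 * (4 * K * 3 ^ m)  ≡⟨ regroup K (3 ^ m) ⟩
  12 * K * 3 ^ m       ≤⟨ ℕ.*-monoˡ-≤ (3 ^ m) (ℕ.≤-trans le (ℕ.m≤n+m m 3)) ⟩
  (3 + m) * 3 ^ m      ≤⟨ bernoulli m ⟩
  3 * 4 ^ m            ∎)
  where
  open ℕ.≤-Reasoning
  regroup : ∀ K x → 3 * (4 * K * x) ≡ 12 * K * x
  regroup = solve-∀

^-distrib-* : ∀ a b n → (a * b) ^ n ≡ a ^ n * b ^ n
^-distrib-* a b zero    = refl
^-distrib-* a b (suc n) = trans (cong (a * b *_) (^-distrib-* a b n)) (interchange a b (a ^ n) (b ^ n))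
  where
  interchange : ∀ a b x y → a * b * (x * y) ≡ a * x * (b * y)
  interchange = solve-∀

module _ (e N : ℕ) where
  private
    d = 2 + e
    B = 3 + e
    k = (1 + e) * N

  -- The factor `4 * (B * B)` accounts for the two surplus bits and the two surplus labels of a
  -- code. Each of the other `k` labels saves a factor ¾ against `2 ^ d`, and together these savings
  -- absorb it.
  labels-bound : 12 * (B * B) ≤ k → 4 * (B * B) * B ^ k ≤ 2 ^ (d * k)
  labels-bound le = ℕ.*-cancelˡ-≤ (4 ^ k) {{ℕ.m^n≢0 4 k}} (begin
    4 ^ k * (4 * (B * B) * B ^ k)          ≡⟨ regroup (4 ^ k) (B * B) (B ^ k) ⟩
    4 * (B * B) * (4 ^ k * B ^ k)          ≡⟨ cong (4 * (B * B) *_) (^-distrib-* 4 B k) ⟨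
    4 * (B * B) * (4 * B) ^ k              ≤⟨ ℕ.*-monoʳ-≤ (4 * (B * B)) (ℕ.^-monoˡ-≤ k (linear-vs-exponential e)) ⟩
    4 * (B * B) * (3 * 2 ^ d) ^ k          ≡⟨ cong (4 * (B * B) *_) (^-distrib-* 3 (2 ^ d) k) ⟩
    4 * (B * B) * (3 ^ k * (2 ^ d) ^ k)    ≡⟨ ℕ.*-assoc (4 * (B * B)) (3 ^ k) _ ⟨
    4 * (B * B) * 3 ^ k * (2 ^ d) ^ k      ≤⟨ ℕ.*-monoˡ-≤ ((2 ^ d) ^ k) (absorb (B * B) k le) ⟩
    4 ^ k * (2 ^ d) ^ k                    ≡⟨ cong (4 ^ k *_) (ℕ.^-*-assoc 2 d k) ⟩
    4 ^ k * 2 ^ (d * k)                    ∎)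
    where
    open ℕ.≤-Reasoning
    regroup : ∀ x y z → x * (4 * y * z) ≡ 4 * y * (x * z)
    regroup = solve-∀

  codes-bound : 12 * (B * B) ≤ N → 2 ^ (d * N + 2) * B ^ (k + 2) ≤ 2 ^ (d ^ 2 * N)
  codes-bound le = begin
    2 ^ (d * N + 2) * B ^ (k + 2)
      ≡⟨ cong₂ _*_ (ℕ.^-distribˡ-+-* 2 (d * N) 2) (ℕ.^-distribˡ-+-* B k 2) ⟩
    2 ^ (d * N) * 4 * (B ^ k * (B * (B * 1)))       ≡⟨ regroup (2 ^ (d * N)) (B ^ k) B ⟩
    2 ^ (d * N) * (4 * (B * B) * B ^ k)
      -- The bound on `N` passes to `k`, which unfolds to `N + e * N`.
      ≤⟨ ℕ.*-monoʳ-≤ (2 ^ (d * N)) (labels-bound (ℕ.≤-trans le (ℕ.m≤m+n N (e * N)))) ⟩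
    2 ^ (d * N) * 2 ^ (d * k)                       ≡⟨ ℕ.^-distribˡ-+-* 2 (d * N) (d * k) ⟨
    2 ^ (d * N + d * k)                             ≡⟨ cong (2 ^_) (exponent e N) ⟩
    2 ^ (d ^ 2 * N)                                 ∎
    where
    open ℕ.≤-Reasoning
    regroup : ∀ x y z → x * 4 * (y * (z * (z * 1))) ≡ x * (4 * (z * z) * y)
    regroup = solve-∀
    exponent : ∀ e N → (2 + e) * N + (2 + e) * ((1 + e) * N) ≡ (2 + e) * ((2 + e) * 1) * N
    exponent = solve-∀

-- Pigeonhole and conclusion

module _ {a p r} {A : Set a} {P : A → Set p} {R : A → A → Set r} {K} (encode : ∀ {x} → P x → Fin K)
         (sound : ∀ {x y} (px : P x) (py : P y) → encode px ≡ encode py → R x y) where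

  private
    codes : ∀ {xs} → All P xs → Fin (length xs) → Fin K
    codes (px ∷ pxs) zero    = encode px
    codes (px ∷ pxs) (suc i) = codes pxs i

    new-code : ∀ {x xs} (px : P x) (pxs : All P xs) → All (λ y → ¬ R x y) xs → ∀ i → encode px ≢ codes pxs i
    new-code px (py ∷ pxs) (¬r ∷ _)  zero    eq = ¬r (sound px py eq)
    new-code px (py ∷ pxs) (_  ∷ ¬rs) (suc i) eq = new-code px pxs ¬rs i eq

    codes-injective : ∀ {xs} (pxs : All P xs) → AllPairs (λ x y → ¬ R x y) xs →
                      ∀ {i j} → codes pxs i ≡ codes pxs j → i ≡ j
    codes-injective (px ∷ pxs) (¬rs ∷ _)  {zero}  {zero}  eq = refl
    codes-injective (px ∷ pxs) (¬rs ∷ _)  {zero}  {suc j} eq = contradiction eq (new-code px pxs ¬rs j)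
    codes-injective (px ∷ pxs) (¬rs ∷ _)  {suc i} {zero}  eq = contradiction (sym eq) (new-code px pxs ¬rs i)
    codes-injective (px ∷ pxs) (_   ∷ ps) {suc i} {suc j} eq = cong suc (codes-injective pxs ps eq)

  -- Codes are attached to positions of the list together with their proofs, so a code may depend on
  -- the chosen construction and not only on the complex.
  pairwise-unrelated-≤ : ∀ {xs} → All P xs → AllPairs (λ x y → ¬ R x y) xs → length xs ≤ K
  pairwise-unrelated-≤ pxs distinct = Fin.injective⇒≤ (codes-injective pxs distinct)

module _ {e N : ℕ} (1≤N : 1 ≤ N) where

  presented : ∀ {C} → IsLC (suc e) C → (eq : #facets (suc e) C ≡ N) → ∃[ T ] Presented {e} T N ×
              Pseudomanifold.facePoset T ≅ SimplicialComplex.facePoset C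
  presented (_ , construction) eq = _ ,
    subst (Presented _) eq (presentation construction (ℕ.≤-trans 1≤N (ℕ.≤-reflexive (sym eq)))) ,
    LocalConstruction.end construction

  lcCode : ∀ {C} → IsSphere (suc e) C × IsLC (suc e) C × #facets (suc e) C ≡ N → Code {e} N
  lcCode (_ , lc , eq) = presentedCode (proj₁ (proj₂ (presented lc eq)))

  lcCode-sound : ∀ {C D} p q → lcCode {C} p ≡ lcCode {D} q → Isomorphic C D
  lcCode-sound {C} {D} (_ , lc , eq) (_ , lc′ , eq′) same =
    let _ , p , isoC = presented lc eq
        _ , q , isoD = presented lc′ eq′
    in same-code⇒isomorphic p q same {C} {D} isoC isoD

theorem2 : ∀ (d : ℕ) → 2 ≤ d →
    ∃[ N₀ ] ∀ (N : ℕ) → N₀ ≤ N → (Cs : List SimplicialComplex) →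
    All (λ C → IsSphere d C × IsLC d C × #facets d C ≡ N) Cs →
    AllPairs (λ C D → ¬ Isomorphic C D) Cs →
    length Cs ≤ 2 ^ (d ^ 2 * N)
theorem2 (suc zero)    (s≤s ())
-- The threshold is 12K with K = (d + 1)², as in `absorb`; it also ensures N ≥ 1.
theorem2 (suc (suc e)) _ = 12 * ((3 + e) * (3 + e)) , λ N N₀≤N Cs lcs distinct →
  let 1≤N = ℕ.≤-trans (s≤s z≤n) N₀≤N
  in ℕ.≤-trans (pairwise-unrelated-≤ (lcCode 1≤N) (lcCode-sound 1≤N) lcs distinct) (codes-bound e N N₀≤N)
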